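{- Let $\kappa,n,m_0\in\mathbb{N}$ be such that there exists a $\kappa$-connected path-complete graph of order $n$ and size at least $m_0$, and let $PK_{n,m_0,\kappa}$ be the one of minimum size among these. Let $D$ be a $\kappa$-connected Eulerian digraph of order $n$ and size at least $2m_0$. Then $$\rho(D)\le \rho(\overleftrightarrow{PK_{n,m_0,\kappa}})=\frac{n}{2\kappa}+2-\frac{1}{\kappa}-\frac{\kappa-1}{n-1}-\frac{m_0}{\kappa(n-1)}.$$ The bound is sharp if $m_0\equiv\binom{n-1}{2}\pmod{\kappa}$ and $$\frac12\left[n(3\kappa-1)-2\kappa^2-\kappa+1-b(\kappa-b)\right]\le m_0\le\binom{n-1}{2},$$ where $b$ is the integer in $\{1,2,\ldots,\kappa\}$ with $b\equiv\binom{n-1}{2}\pmod{\kappa}$.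
   Context: Graphs and digraphs are finite, without loops or multiple edges/arcs (opposite arcs are allowed). $\mathbb{N}$ denotes the positive integers. Order is the number of vertices; size is the number of edges of a graph, respectively arcs of a digraph. A digraph is strong if there is a directed path between every ordered pair of vertices. An Eulerian digraph is a strong digraph that contains an Eulerian circuit (a closed directed trail using every arc). The vertex-connectivity of a digraph is the minimum number of vertices whose removal results in a digraph that is not strong; a digraph is $\kappa$-connected if its vertex-connectivity is at least $\kappa$. For a strong digraph $D$ of order $n\ge2$, the remoteness is $\rho(D)=\max_{v\in V(D)}\frac{1}{n-1}\sum_{w\in V(D)}d_D(v,w)$, where $d_D(v,w)$ is the length of a shortest directed path from $v$ to $w$. For a graph $G$, $\overleftrightarrow{G}$ is the digraph obtained by replacing each edge by two arcs in opposite directions. For disjoint graphs $G_1,\ldots,G_k$, the sequential sum $G_1+\cdots+G_k$ is obtained from their union by joining every vertex of $G_i$ to every vertex of $G_{i+1}$, $i=1,\ldots,k-1$. A $\kappa$-connected path-complete graph is a graph of the form $K_1+[K_\kappa]^{\ell}+K_a+K_b$ with $\ell,a,b\in\mathbb{N}$, $a\ge\kappa$ (here $b$ is a parameter of the construction), where $K_r$ is the complete graph on $r$ vertices and $[K_\kappa]^{\ell}$ stands for $\ell$ consecutive terms $K_\kappa+\cdots+K_\kappa$.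
   Formalization: The printed equality fails (κ=2, n=6, m_0=9): proved with the size of PK for m_0, and as ≤ for m_0 itself, with equality in the sharp range. The printed b fails (κ=16, n=49, m_0=872): b ≡ n-1 (mod κ) replaces b ≡ C(n-1,2). -}

module Defs where

open import Data.Bool.Base using (Bool; true; false; T; _∧_; if_then_else_)
open import Data.Bool.Properties using (T?)
open import Data.Empty using (⊥-elim)
open import Data.Fin.Base using (Fin; zero; suc; toℕ; splitAt)
open import Data.Fin.Properties using (any?; injective⇒≤) renaming (_≟_ to _≟ᶠ_)
open import Data.Fin.Subset using (Subset; ∣_∣)
open import Data.Fin.Subset.Properties using (_∈?_)
open import Data.Integer.Base as ℤ using (ℤ; +_; 1ℤ)
open import Data.List.Base using (List; []; _∷_; _++_; length; map; foldr; filter; filterᵇ; replicate; allFin; cartesianProduct; lookup)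
open import Data.List.Membership.Propositional using (_∈_)
open import Data.List.Relation.Unary.All using (All; []; _∷_)
open import Data.List.Relation.Unary.All.Properties using (¬Any⇒All¬)
open import Data.List.Relation.Unary.Any using (here; there)
open import Data.List.Relation.Unary.AllPairs using ([]; _∷_)
open import Data.List.Relation.Unary.Unique.Propositional using (Unique)
open import Data.Nat.Base using (ℕ; zero; suc; _+_; _*_; _∸_; _≤_; _<_; z≤n; s≤s; _<ᵇ_; ∣_-_∣)
open import Data.Nat.Divisibility using (_∣_)
open import Data.Nat.ListAction using (sum)
open import Data.Nat.Properties using (≤-trans; ≤-refl; ≤-antisym; m≤n⇒m≤1+n; suc-injective)
open import Data.Product.Base using (Σ; ∃-syntax; _×_; _,_; proj₁; uncurry)
open import Data.Rational.Base as ℚ using (ℚ; 0ℚ; ½)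
open import Data.Sum.Base using (_⊎_; inj₁; inj₂)
open import Function.Base using (_∘_)
open import Relation.Binary.PropositionalEquality using (_≡_; refl; sym; cong; subst)
open import Relation.Nullary using (¬_; Dec; yes; no; does; ¬?)
open import Relation.Nullary.Decidable using (map′; _×-dec_)
import Data.List.Membership.DecPropositional as DecMembership

record Graph : Set where
  field
    order     : ℕ
    edge      : Fin order → Fin order → Bool
    loopless  : ∀ v → edge v v ≡ false
    symmetric : ∀ u v → edge u v ≡ edge v u

record Digraph : Set where
  field
    order    : ℕ
    arc      : Fin order → Fin order → Bool
    loopless : ∀ v → arc v v ≡ false

  Vertex : Set
  Vertex = Fin order

  arcs : List (Vertex × Vertex)
  arcs = filterᵇ (uncurry arc) (cartesianProduct (allFin order) (allFin order))

  size : ℕ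
  size = length arcs

graphSize : Graph → ℕ
graphSize G = length (filterᵇ (λ (u , v) → (toℕ u <ᵇ toℕ v) ∧ edge u v)
                              (cartesianProduct (allFin order) (allFin order)))
  where open Graph G

bidirected : Graph → Digraph
bidirected G = record { order = order ; arc = edge ; loopless = loopless }
  where open Graph G

module _ (D : Digraph) where
  open Digraph D

  infixr 5 _∷_

  data Walk : Vertex → Vertex → Set where
    []  : ∀ {v} → Walk v v
    _∷_ : ∀ {u v w} → T (arc u v) → Walk v w → Walk u w

module _ {D : Digraph} where
  open Digraph D

  walkLength : ∀ {u v} → Walk D u v → ℕ
  walkLength []      = 0
  walkLength (_ ∷ p) = suc (walkLength p)

  walkVertices : ∀ {u v} → Walk D u v → List Vertex
  walkVertices {u} []      = u ∷ []
  walkVertices {u} (_ ∷ p) = u ∷ walkVertices p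

  walkArcs : ∀ {u v} → Walk D u v → List (Vertex × Vertex)
  walkArcs []                        = []
  walkArcs (_∷_ {u = u} {v = v} _ p) = (u , v) ∷ walkArcs p

module _ (D : Digraph) where
  open Digraph D

  Path : Vertex → Vertex → Set
  Path u v = Σ (Walk D u v) λ p → Unique (walkVertices p)

  Strong : Set
  Strong = ∀ u v → Path u v

  IsEulerianCircuit : ∀ {v} → Walk D v v → Set
  IsEulerianCircuit p = Unique (walkArcs p) × (∀ u w → T (arc u w) → (u , w) ∈ walkArcs p)

  Eulerian : Set
  Eulerian = Strong × ∃[ v ] Σ (Walk D v v) IsEulerianCircuit

-- Subdigraph induced by the vertices outside S, relabelled 0, 1, … in
-- increasing order.
removeVertices : (D : Digraph) → Subset (Digraph.order D) → Digraph
removeVertices D S = record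
  { order    = length kept
  ; arc      = λ i j → arc (lookup kept i) (lookup kept j)
  ; loopless = λ i → loopless (lookup kept i)
  }
  where
  open Digraph D
  kept : List Vertex
  kept = filter (λ v → ¬? (v ∈? S)) (allFin order)

-- The vertex-connectivity is the minimum of ∣ S ∣ over the sets S whose removal
-- leaves a non-strong digraph; this says that this minimum is at least κ.
-- A complete digraph has no such S and is κ-connected for every κ; in the
-- theorem n ≥ 2κ + 2, so the customary value n - 1 would give the same.
Connected : ℕ → Digraph → Set
Connected κ D = ∀ S → ¬ Strong (removeVertices D S) → κ ≤ ∣ S ∣

module _ (D : Digraph) where
  open Digraph D

  walkOfLength? : ∀ k u v → Dec (Σ (Walk D u v) λ p → walkLength p ≡ k)
  walkOfLength? zero u v with u ≟ᶠ v
  ... | yes refl = yes ([] , refl)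
  ... | no  u≢v  = no λ { ([] , _) → u≢v refl ; (_ ∷ _ , ()) }
  walkOfLength? (suc k) u v =
    map′ (λ { (_ , a , p , eq) → a ∷ p , cong suc eq })
         (λ { (a ∷ p , eq) → _ , a , p , suc-injective eq })
         (any? λ w → T? (arc u w) ×-dec walkOfLength? k w v)

-- The least k < n with P k, and n if there is none.
least : (ℕ → Bool) → ℕ → ℕ
least P zero    = zero
least P (suc n) = if P zero then zero else suc (least (P ∘ suc) n)

-- Some walk of length k from u to v exists for k = d(u,v) and for no smaller k,
-- and d(u,v) < order; dist-correct below proves that this is the length of a
-- shortest path. The value is order if v is not reachable from u.
dist : (D : Digraph) → Digraph.Vertex D → Digraph.Vertex D → ℕ
dist D u v = least (λ k → does (walkOfLength? D k u v)) (Digraph.order D)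

-- Division of natural numbers, with p ⁄ 0 = 0.
infixl 7 _⁄_
_⁄_ : ℕ → ℕ → ℚ
p ⁄ zero  = 0ℚ
p ⁄ suc q = + p ℚ./ suc q

averageDistance : (D : Digraph) → Digraph.Vertex D → ℚ
averageDistance D v = 1 ⁄ (order ∸ 1) ℚ.* (sum (map (dist D v) (allFin order)) ⁄ 1)
  where open Digraph D

-- Meaningful for strong digraphs of order at least 2. The averages are
-- nonnegative, so starting the maximum from 0 has no effect.
remoteness : Digraph → ℚ
remoteness D = foldr ℚ._⊔_ 0ℚ (map (averageDistance D) (allFin (Digraph.order D)))

complete : ℕ → Graph
complete r = record
  { order     = r
  ; edge      = λ u v → does (¬? (u ≟ᶠ v))
  ; loopless  = irr
  ; symmetric = symm
  }
  where
  irr : ∀ (v : Fin r) → does (¬? (v ≟ᶠ v)) ≡ false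
  irr v with v ≟ᶠ v
  ... | yes _   = refl
  ... | no  v≢v = ⊥-elim (v≢v refl)
  symm : ∀ (u v : Fin r) → does (¬? (u ≟ᶠ v)) ≡ does (¬? (v ≟ᶠ u))
  symm u v with u ≟ᶠ v | v ≟ᶠ u
  ... | yes _  | yes _  = refl
  ... | no  _  | no  _  = refl
  ... | yes eq | no  ne = ⊥-elim (ne (sym eq))
  ... | no  ne | yes eq = ⊥-elim (ne (sym eq))

headOrder : List Graph → ℕ
headOrder []      = 0
headOrder (G ∷ _) = Graph.order G

-- In the sequential sum of G ∷ Gs, the vertices of G come first, and they are
-- joined to the first headOrder Gs vertices of the sequential sum of Gs, which
-- are those of the second summand.
sequentialSum : List Graph → Graph
sequentialSum [] = complete 0
sequentialSum (G ∷ Gs) = record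
  { order     = order G + order R
  ; edge      = λ u v → adj (splitAt (order G) u) (splitAt (order G) v)
  ; loopless  = λ v → irr (splitAt (order G) v)
  ; symmetric = λ u v → symm (splitAt (order G) u) (splitAt (order G) v)
  }
  where
  open Graph
  R : Graph
  R = sequentialSum Gs
  adj : Fin (order G) ⊎ Fin (order R) → Fin (order G) ⊎ Fin (order R) → Bool
  adj (inj₁ u) (inj₁ v) = edge G u v
  adj (inj₁ u) (inj₂ v) = toℕ v <ᵇ headOrder Gs
  adj (inj₂ u) (inj₁ v) = toℕ u <ᵇ headOrder Gs
  adj (inj₂ u) (inj₂ v) = edge R u v
  irr : ∀ x → adj x x ≡ false
  irr (inj₁ v) = loopless G v
  irr (inj₂ v) = loopless R v
  symm : ∀ x y → adj x y ≡ adj y x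
  symm (inj₁ u) (inj₁ v) = symmetric G u v
  symm (inj₁ u) (inj₂ v) = refl
  symm (inj₂ u) (inj₁ v) = refl
  symm (inj₂ u) (inj₂ v) = symmetric R u v

PathComplete : ℕ → Graph → Set
PathComplete κ G =
  ∃[ ℓ ] ∃[ a ] ∃[ b ] 1 ≤ ℓ × 1 ≤ a × 1 ≤ b × κ ≤ a ×
    G ≡ sequentialSum (complete 1 ∷ replicate ℓ (complete κ) ++ complete a ∷ complete b ∷ [])

record IsMinimumPathComplete (n m₀ κ : ℕ) (G : Graph) : Set where
  field
    pathComplete : PathComplete κ G
    order≡n      : Graph.order G ≡ n
    m₀≤size      : m₀ ≤ graphSize G
    minimum      : ∀ H → PathComplete κ H → Graph.order H ≡ n → m₀ ≤ graphSize H →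
                   graphSize G ≤ graphSize H

record Admissible (n m₀ κ : ℕ) (D : Digraph) : Set where
  field
    connected : Connected κ D
    eulerian  : Eulerian D
    order≡n   : Digraph.order D ≡ n
    2m₀≤size  : 2 * m₀ ≤ Digraph.size D

-- The subtractions ∸ are exact, as κ and n are positive.
remotenessBound : (n m κ : ℕ) → ℚ
remotenessBound n m κ =
  n ⁄ (2 * κ) ℚ.+ 2 ⁄ 1 ℚ.- 1 ⁄ κ ℚ.- (κ ∸ 1) ⁄ (n ∸ 1) ℚ.- m ⁄ (κ * (n ∸ 1))

-- When b ≡ n - 1 modulo κ and n ≥ 2κ + 2, this is the least size of a
-- κ-connected path-complete graph of order n (the one with last term K_b and a = κ).
sharpnessThreshold : (n κ b : ℕ) → ℚ
sharpnessThreshold n κ b =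
  ½ ℚ.* (( + n ℤ.* (+ 3 ℤ.* + κ ℤ.- 1ℤ) ℤ.- + 2 ℤ.* (+ κ ℤ.* + κ) ℤ.- + κ ℤ.+ 1ℤ
           ℤ.- + b ℤ.* (+ κ ℤ.- + b)) ℚ./ 1)

infix 4 _≡_modulo_
_≡_modulo_ : ℕ → ℕ → ℕ → Set
x ≡ y modulo κ = κ ∣ ∣ x - y ∣

IsDistance : (D : Digraph) → (u v : Digraph.Vertex D) → ℕ → Set
IsDistance D u v k =
  Σ (Path D u v) (λ p → walkLength (proj₁ p) ≡ k) × (∀ (p : Path D u v) → k ≤ walkLength (proj₁ p))

private
  lookup-All : ∀ {A : Set} {P : A → Set} {xs : List A} → All P xs → ∀ i → P (lookup xs i)
  lookup-All (px ∷ _)   zero    = px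
  lookup-All (_  ∷ pxs) (suc i) = lookup-All pxs i

  lookup-injective : ∀ {A : Set} {xs : List A} → Unique xs →
                     ∀ {i j} → lookup xs i ≡ lookup xs j → i ≡ j
  lookup-injective (_ ∷ _)    {zero}  {zero}  _  = refl
  lookup-injective (x≢xs ∷ _) {zero}  {suc j} eq = ⊥-elim (lookup-All x≢xs j eq)
  lookup-injective (x≢xs ∷ _) {suc i} {zero}  eq = ⊥-elim (lookup-All x≢xs i (sym eq))
  lookup-injective (_ ∷ uxs)  {suc i} {suc j} eq = cong suc (lookup-injective uxs eq)

  least-≤ : ∀ (P : ℕ → Bool) n k → P k ≡ true → least P n ≤ k
  least-≤ P zero    k       _  = z≤n
  least-≤ P (suc n) zero    eq rewrite eq = z≤n
  least-≤ P (suc n) (suc k) eq with P zero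
  ... | true  = z≤n
  ... | false = s≤s (least-≤ (P ∘ suc) n k eq)

  least-true : ∀ (P : ℕ → Bool) n k → k < n → P k ≡ true → P (least P n) ≡ true
  least-true P (suc n) zero    _         eq rewrite eq = eq
  least-true P (suc n) (suc k) (s≤s k<n) eq with P zero in eq₀
  ... | true  = eq₀
  ... | false = least-true (P ∘ suc) n k k<n eq

  does-true : ∀ {A : Set} (a? : Dec A) → A → does a? ≡ true
  does-true (yes _) _ = refl
  does-true (no ¬a) a = ⊥-elim (¬a a)

  true-holds : ∀ {A : Set} (a? : Dec A) → does a? ≡ true → A
  true-holds (yes a) _ = a

module _ (D : Digraph) where
  open Digraph D

  private
    length-vertices : ∀ {u v} (p : Walk D u v) → length (walkVertices p) ≡ suc (walkLength p)
    length-vertices []      = refl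
    length-vertices (_ ∷ p) = cong suc (length-vertices p)

    short : ∀ {u v} (p : Path D u v) → walkLength (proj₁ p) < order
    short (p , unique) =
      subst (_≤ order) (length-vertices p) (injective⇒≤ (λ {i} {j} → lookup-injective unique {i} {j}))

    Within : ℕ → Vertex → Vertex → Set
    Within k u v = Σ (Path D u v) λ p → walkLength (proj₁ p) ≤ k

    suffix : ∀ {u v w} (p : Walk D v w) → Unique (walkVertices p) → u ∈ walkVertices p →
             Within (walkLength p) u w
    suffix []      un        (here refl) = ([] , un) , z≤n
    suffix (a ∷ p) un        (here refl) = (a ∷ p , un) , ≤-refl
    suffix (a ∷ p) (_ ∷ un)  (there u∈p) with suffix p un u∈p
    ... | q , le = q , m≤n⇒m≤1+n le

    toPath : ∀ {u v} (p : Walk D u v) → Within (walkLength p) u v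
    toPath []                = ([] , [] ∷ []) , z≤n
    toPath (_∷_ {u = u} a p) with toPath p
    ... | (q , un) , le with DecMembership._∈?_ _≟ᶠ_ u (walkVertices q)
    ...   | no  u∉q = (a ∷ q , ¬Any⇒All¬ _ u∉q ∷ un) , s≤s le
    ...   | yes u∈q with suffix q un u∈q
    ...     | r , le′ = r , m≤n⇒m≤1+n (≤-trans le′ le)

  dist-correct : ∀ {u v} → Path D u v → IsDistance D u v (dist D u v)
  dist-correct {u} {v} p₀ = go (true-holds (walk? (dist D u v)) (least-true (does ∘ walk?) order _ (short p₀) (found p₀)))
    where
    walk? : ∀ k → Dec (Σ (Walk D u v) λ p → walkLength p ≡ k)
    walk? k = walkOfLength? D k u v
    found : (p : Path D u v) → does (walk? (walkLength (proj₁ p))) ≡ true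
    found (p , _) = does-true (walk? (walkLength p)) (p , refl)
    below : ∀ (p : Path D u v) → dist D u v ≤ walkLength (proj₁ p)
    below p = least-≤ (does ∘ walk?) order _ (found p)
    go : Σ (Walk D u v) (λ p → walkLength p ≡ dist D u v) → IsDistance D u v (dist D u v)
    go (p , eq) with toPath p
    ... | q , le = (q , ≤-antisym (subst (walkLength (proj₁ q) ≤_) eq le) (below q)) , below

{-# OPTIONS --safe #-}

-- Fix a vertex v of D, let f be the distance from v and σ the sum of f. An arc u → w
-- has f w ≤ f u + 1, and f w - f u sums to 0 along the Eulerian circuit; so there are at
-- most as many arcs going down in f as going up, and the size of D is at most n (n - 1) - 2 P,
-- where P counts the pairs with f u + 2 ≤ f w. By κ-connectedness every level strictly
-- between v and the last level has at least κ vertices, hence P ≥ Σ (1 + κ (f w - 2)) over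
-- the w with f w ≥ 2, which gives
--   2 κ σ + size + n + 2 κ² ≤ N² + 4 κ N + 1 + 2 κ,   N = n - 1.
-- Path-complete graphs attain equality. If (ℓ, a, b) are the parameters of the minimum one,
-- then (ℓ, a - 1, b + 1) or (ℓ + 1, b - 1, 1) has σ larger by one and size smaller by κ, so
-- it has fewer than m₀ edges; a D with larger σ would therefore have fewer than 2 m₀ arcs.
-- The exception is a = κ, b ≤ κ, where σ is largest among all distributions of n vertices
-- over levels whose inner ones have at least κ vertices. In the sharp case all sizes are congruent to m₀
-- modulo κ, so the same step shows that the minimum size is m₀ itself.
module Submission where

open import Defs
open import Data.Bool.Base using (Bool; T; _∧_; false; if_then_else_; true)
open import Data.Bool.Properties using (T?)
open import Data.Fin.Base using (Fin; _↑ʳ_; _↑ˡ_; splitAt; suc; toℕ; zero)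
open import Data.Fin.Properties using (any?; splitAt-↑ʳ; splitAt-↑ˡ; splitAt⁻¹-↑ʳ; splitAt⁻¹-↑ˡ; toℕ-injective; toℕ-↑ʳ; toℕ-↑ˡ; toℕ<n) renaming (_≟_ to _≟ᶠ_)
open import Data.Fin.Subset using (Subset; ∣_∣; ⊥) renaming (_∈_ to _∈ˢ_; _∉_ to _∉ˢ_)
open import Data.Fin.Subset.Properties using (_∈?_; ∣⊥∣≡0)
open import Data.Integer.Base as ℤ using (1ℤ; ℤ) renaming (+_ to pos)
import Data.Integer.Properties as ℤ
import Data.Integer.Tactic.RingSolver as ℤ-Solver
open import Data.List.Base using (List; []; _++_; _∷_; allFin; cartesianProduct; filter; filterᵇ; foldr; length; lookup; map; replicate; tabulate)
import Data.List.Membership.DecPropositional as DecMembership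
open import Data.List.Membership.Propositional using (_∈_; _∉_)
open import Data.List.Membership.Propositional.Properties using (∈-++⁺ʳ; ∈-++⁺ˡ; ∈-++⁻; ∈-allFin; ∈-cartesianProduct⁺; ∈-filter⁺; ∈-filter⁻; ∈-lookup; ∈-∃++)
open import Data.List.Properties using (map-++; map-replicate; map-tabulate; map-∘)
open import Data.List.Relation.Binary.Permutation.Propositional using (_↭_; prep; swap; ↭-refl; ↭-sym; ↭-trans; ↭⇒↭ₛ)
open import Data.List.Relation.Binary.Permutation.Propositional.Properties using (↭-length; ∈-resp-↭)
open import Data.List.Relation.Binary.Permutation.Setoid.Properties using (Unique-resp-↭)
open import Data.List.Relation.Unary.All as All using ([]; _∷_)
open import Data.List.Relation.Unary.All.Properties using (¬Any⇒All¬)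
open import Data.List.Relation.Unary.AllPairs using ([]; _∷_)
open import Data.List.Relation.Unary.Any using (here; index; there)
open import Data.List.Relation.Unary.Any.Properties using (lookup-index)
open import Data.List.Relation.Unary.Unique.Propositional using (Unique)
open import Data.List.Relation.Unary.Unique.Propositional.Properties using (allFin⁺; cartesianProduct⁺; filter⁺)
open import Data.Nat.Base hiding (_⊔_; ∣_-_∣)
open import Data.Nat.Combinatorics using (_C_; nC1≡n; nCk+nC[k+1]≡[n+1]C[k+1])
open import Data.Nat.Divisibility using (_∣_; divides; m∣m*n; ∣m+n∣m⇒∣n; ∣⇒≤)
open import Data.Nat.ListAction using () renaming (sum to sumᴸ)
open import Data.Nat.ListAction.Properties using (sum-++)
open import Data.Nat.Properties
open import Data.Nat.Tactic.RingSolver using (solve-∀)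
open import Data.Product.Base using (_,_; _×_; proj₁; proj₂; uncurry; Σ; ∃-syntax)
open import Data.Product.Properties using (≡-dec)
open import Data.Rational.Base as ℚ using (0ℚ; toℚᵘ; ½)
import Data.Rational.Properties as ℚ
open import Data.Rational.Unnormalised.Base as ℚᵘ using (*≡*; *≤*; mkℚᵘ)
import Data.Rational.Unnormalised.Properties as ℚᵘ
open import Data.Sum.Base using ([_,_]′; _⊎_; inj₁; inj₂)
open import Data.Vec.Base as Vec using ([]; _∷_)
open import Data.Vec.Properties using ([]=⇒lookup; lookup⇒[]=; lookup∘tabulate)
open import Function.Base using (_∘_; const)
open import Relation.Binary.Definitions using (tri<; tri>; tri≈)
open import Relation.Binary.PropositionalEquality
open import Relation.Nullary using (contradiction; does; no; yes; ¬?; ¬_)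
open import Relation.Nullary.Decidable using (_×-dec_; dec-true)
open import Algebra.Properties.Semiring.Sum +-*-semiring using (∑-distrib-+; ∑-comm; *-distribˡ-sum; sum-cong-≗) renaming (sum to ∑)

-- Sums and counting

𝟙 : Bool → ℕ
𝟙 b = if b then 1 else 0

δ : ∀ {n} → Fin n → Fin n → ℕ
δ u w = 𝟙 (does (u ≟ᶠ w))

∑-mono : ∀ {n} {f g : Fin n → ℕ} → (∀ i → f i ≤ g i) → ∑ f ≤ ∑ g
∑-mono {zero}  f≤g = z≤n
∑-mono {suc n} f≤g = +-mono-≤ (f≤g zero) (∑-mono (f≤g ∘ suc))

∑-const : ∀ n c → ∑ {n} (λ _ → c) ≡ n * c
∑-const zero    c = refl
∑-const (suc n) c = cong (c +_) (∑-const n c)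

∑-↑ : ∀ m {n} (f : Fin (m + n) → ℕ) → ∑ f ≡ ∑ (λ i → f (i ↑ˡ n)) + ∑ (λ j → f (m ↑ʳ j))
∑-↑ zero    f = refl
∑-↑ (suc m) f = trans (cong (f zero +_) (∑-↑ m (f ∘ suc))) (sym (+-assoc (f zero) _ _))

∑-δ : ∀ {n} (u : Fin n) → ∑ (δ u) ≡ 1
∑-δ {suc n} zero    = cong suc (trans (∑-const n 0) (*-zeroʳ n))
∑-δ {suc n} (suc u) = trans (sum-cong-≗ δ-suc) (∑-δ u)
  where
  δ-suc : ∀ w → δ (suc u) (suc w) ≡ δ u w
  δ-suc w with u ≟ᶠ w
  ... | yes _ = refl
  ... | no  _ = refl

δ-≢ : ∀ {n} {u w : Fin n} → u ≢ w → δ u w ≡ 0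
δ-≢ {u = u} {w} u≢w with u ≟ᶠ w
... | yes u≡w = contradiction u≡w u≢w
... | no  _   = refl

𝟙-true : ∀ {b} → T b → 𝟙 b ≡ 1
𝟙-true {true} _ = refl

∣∣-∑ : ∀ {n} (S : Subset n) → ∣ S ∣ ≡ ∑ (λ i → 𝟙 (Vec.lookup S i))
∣∣-∑ []          = refl
∣∣-∑ (true  ∷ S) = cong suc (∣∣-∑ S)
∣∣-∑ (false ∷ S) = ∣∣-∑ S

sum-allFin : ∀ {n} (f : Fin n → ℕ) → sumᴸ (map f (allFin n)) ≡ ∑ f
sum-allFin f = trans (cong sumᴸ (map-tabulate (λ i → i) f)) (go f)
  where
  go : ∀ {n} (f : Fin n → ℕ) → sumᴸ (tabulate f) ≡ ∑ f
  go {zero}  f = refl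
  go {suc n} f = cong (f zero +_) (go (f ∘ suc))

module _ {A : Set} where

  length-filterᵇ : ∀ (p : A → Bool) xs → length (filterᵇ p xs) ≡ sumᴸ (map (𝟙 ∘ p) xs)
  length-filterᵇ p []       = refl
  length-filterᵇ p (x ∷ xs) with p x
  ... | true  = cong suc (length-filterᵇ p xs)
  ... | false = length-filterᵇ p xs

  sum-map-1 : ∀ (xs : List A) → sumᴸ (map (λ _ → 1) xs) ≡ length xs
  sum-map-1 []       = refl
  sum-map-1 (_ ∷ xs) = cong suc (sum-map-1 xs)

  -- Each element of `xs` uses up one occurrence in `ys`, which is split off. As `xs` has no
  -- repetitions, its tail still lies in what remains.
  sum-⊆ : ∀ (c : A → ℕ) {xs ys} → Unique xs → (∀ {x} → x ∈ xs → x ∈ ys) →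
          sumᴸ (map c xs) ≤ sumᴸ (map c ys)
  sum-⊆ c                []         xs⊆ys = z≤n
  sum-⊆ c {x ∷ xs} {ys} (x∉xs ∷ un) xs⊆ys with ∈-∃++ (xs⊆ys (here refl))
  ... | as , bs , refl = begin
    c x + sumᴸ (map c xs)                              ≤⟨ +-monoʳ-≤ (c x) (sum-⊆ c un xs⊆as++bs) ⟩
    c x + sumᴸ (map c (as ++ bs))                      ≡⟨ cong (λ s → c x + s) (splits as bs) ⟩
    c x + (sumᴸ (map c as) + sumᴸ (map c bs))
      ≡⟨ rearrange (c x) (sumᴸ (map c as)) (sumᴸ (map c bs)) ⟩
    sumᴸ (map c as) + (c x + sumᴸ (map c bs))          ≡⟨ splits as (x ∷ bs) ⟨
    sumᴸ (map c (as ++ x ∷ bs))                        ∎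
    where
    open ≤-Reasoning
    splits : ∀ as bs → sumᴸ (map c (as ++ bs)) ≡ sumᴸ (map c as) + sumᴸ (map c bs)
    splits as bs = trans (cong sumᴸ (map-++ c as bs)) (sum-++ (map c as) (map c bs))
    rearrange : ∀ p q r → p + (q + r) ≡ q + (p + r)
    rearrange = solve-∀
    xs⊆as++bs : ∀ {y} → y ∈ xs → y ∈ as ++ bs
    xs⊆as++bs y∈xs with ∈-++⁻ as (xs⊆ys (there y∈xs))
    ... | inj₁ y∈as           = ∈-++⁺ˡ y∈as
    ... | inj₂ (here refl)    = contradiction refl (All.lookup x∉xs y∈xs)
    ... | inj₂ (there y∈bs)   = ∈-++⁺ʳ as y∈bs

  length-⊆ : ∀ {xs ys : List A} → Unique xs → (∀ {x} → x ∈ xs → x ∈ ys) → length xs ≤ length ys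
  length-⊆ {xs} {ys} un xs⊆ys = subst₂ _≤_ (sum-map-1 xs) (sum-map-1 ys) (sum-⊆ (λ _ → 1) un xs⊆ys)

pairs : ∀ n → List (Fin n × Fin n)
pairs n = cartesianProduct (allFin n) (allFin n)

∈-pairs : ∀ {n} (e : Fin n × Fin n) → e ∈ pairs n
∈-pairs (u , w) = ∈-cartesianProduct⁺ (∈-allFin u) (∈-allFin w)

sum-pairs : ∀ {n} (c : Fin n × Fin n → ℕ) → sumᴸ (map c (pairs n)) ≡ ∑ λ u → ∑ λ w → c (u , w)
sum-pairs {n} c = trans (go (allFin n)) (trans (sum-allFin row)
                          (sum-cong-≗ {n} {row} λ u → sum-allFin (λ w → c (u , w))))
  where
  row : Fin n → ℕ
  row u = sumᴸ (map (λ w → c (u , w)) (allFin n))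
  go : ∀ us → sumᴸ (map c (cartesianProduct us (allFin n))) ≡
              sumᴸ (map row us)
  go []       = refl
  go (u ∷ us) = begin
    sumᴸ (map c (map (u ,_) ws ++ cartesianProduct us ws))
      ≡⟨ cong sumᴸ (map-++ c (map (u ,_) ws) _) ⟩
    sumᴸ (map c (map (u ,_) ws) ++ map c (cartesianProduct us ws))
      ≡⟨ sum-++ (map c (map (u ,_) ws)) _ ⟩
    sumᴸ (map c (map (u ,_) ws)) + sumᴸ (map c (cartesianProduct us ws))
      ≡⟨ cong₂ _+_ (cong sumᴸ (sym (map-∘ ws))) (go us) ⟩
    sumᴸ (map (λ w → c (u , w)) ws) + _                                 ∎
    where
    open ≡-Reasoning
    ws = allFin n

-- Levels of a function on a finite set

-- Arcs allowed between levels a and b, in both directions, once the backward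
-- arcs have been traded for forward ones.
cost : ℕ → ℕ → ℕ
cost a b = 𝟙 (a ≡ᵇ b) + 2 * 𝟙 (suc a ≡ᵇ b)

cost-refl : ∀ a → cost a a ≡ 1
cost-refl zero    = refl
cost-refl (suc a) = cost-refl a

-- The trade for one arc: it may cost 2 when it climbs, 1 when it stays level and nothing when it
-- descends, because the descent itself pays. Summed along a closed walk, the levels cancel.
cost-step : ∀ a b → b ≤ suc a → 1 + b ≤ cost a b + a
cost-step zero    zero          _         = s≤s z≤n
cost-step zero    (suc zero)    _         = s≤s (s≤s z≤n)
cost-step zero    (suc (suc b)) (s≤s ())
cost-step (suc a) zero          _         = s≤s z≤n
cost-step (suc a) (suc b)       (s≤s b≤a) =
  subst (2 + b ≤_) (sym (+-suc (cost a b) a)) (s≤s (cost-step a b b≤a))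

-- Two levels are equal (cost 1 in each order), consecutive (cost 2 in one order) or far apart
-- (counted by `<ᵇ` in one order).
cost-total : ∀ a b → (cost a b + 2 * 𝟙 (suc a <ᵇ b)) + (cost b a + 2 * 𝟙 (suc b <ᵇ a)) ≡ 2
cost-total zero          zero          = refl
cost-total zero          (suc zero)    = refl
cost-total zero          (suc (suc b)) = refl
cost-total (suc zero)    zero          = refl
cost-total (suc (suc a)) zero          = refl
cost-total (suc a)       (suc b)       = cost-total a b

𝟙-<ᵇ-suc : ∀ j k → 𝟙 (j <ᵇ suc k) ≡ 𝟙 (j <ᵇ k) + 𝟙 (j ≡ᵇ k)
𝟙-<ᵇ-suc zero    zero    = refl
𝟙-<ᵇ-suc zero    (suc k) = refl
𝟙-<ᵇ-suc (suc j) zero    = refl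
𝟙-<ᵇ-suc (suc j) (suc k) = 𝟙-<ᵇ-suc j k

∸-𝟙 : ∀ k j → suc k ∸ j ≡ (k ∸ j) + 𝟙 (j <ᵇ suc k)
∸-𝟙 k       zero    = sym (+-comm k 1)
∸-𝟙 zero    (suc j) = 0∸n≡0 j
∸-𝟙 (suc k) (suc j) = ∸-𝟙 k j

module _ {n : ℕ} (f : Fin n → ℕ) where

  levelSize : ℕ → ℕ
  levelSize i = ∑ λ u → 𝟙 (f u ≡ᵇ i)

  ballSize : ℕ → ℕ
  ballSize i = ∑ λ u → 𝟙 (f u <ᵇ suc i)

  farPairs : ℕ
  farPairs = ∑ λ u → ∑ λ w → 𝟙 (suc (f u) <ᵇ f w)

  -- `cost-total` concerns an ordered pair together with its transpose, so the double sum is doubled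
  -- and one copy transposed.
  ∑-cost : ∑ (λ u → ∑ λ w → cost (f u) (f w)) + 2 * farPairs ≡ n * n
  ∑-cost = *-cancelˡ-≡ _ _ 2 (begin
    2 * (∑ (λ u → ∑ (c u)) + 2 * farPairs)                   ≡⟨ cong (2 *_) split ⟩
    2 * ∑ (λ u → ∑ (h u))
      ≡⟨ cong (∑ (λ u → ∑ (h u)) +_) (+-identityʳ _) ⟩
    ∑ (λ u → ∑ (h u)) + ∑ (λ u → ∑ (h u))                    ≡⟨ cong (∑ (λ u → ∑ (h u)) +_) (∑-comm h) ⟩
    ∑ (λ u → ∑ (h u)) + ∑ (λ u → ∑ λ w → h w u)
      ≡⟨ ∑-distrib-+ (λ u → ∑ (h u)) (λ u → ∑ λ w → h w u) ⟨
    ∑ (λ u → ∑ (h u) + ∑ λ w → h w u)                        ≡⟨ sum-cong-≗ row ⟩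
    ∑ {n} (λ _ → n * 2)                                      ≡⟨ ∑-const n (n * 2) ⟩
    n * (n * 2)                                              ≡⟨ final n ⟩
    2 * (n * n)                                              ∎)
    where
    open ≡-Reasoning
    c far h : Fin n → Fin n → ℕ
    c u w = cost (f u) (f w)
    far u w = 𝟙 (suc (f u) <ᵇ f w)
    h u w = c u w + 2 * far u w
    final : ∀ n → n * (n * 2) ≡ 2 * (n * n)
    final = solve-∀
    row : ∀ u → ∑ (h u) + ∑ (λ w → h w u) ≡ n * 2
    row u = begin
      ∑ (h u) + ∑ (λ w → h w u)     ≡⟨ ∑-distrib-+ (h u) (λ w → h w u) ⟨
      ∑ (λ w → h u w + h w u)       ≡⟨ sum-cong-≗ (λ w → cost-total (f u) (f w)) ⟩
      ∑ {n} (λ _ → 2)               ≡⟨ ∑-const n 2 ⟩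
      n * 2                         ∎
    split : ∑ (λ u → ∑ (c u)) + 2 * farPairs ≡ ∑ (λ u → ∑ (h u))
    split = begin
      ∑ (λ u → ∑ (c u)) + 2 * farPairs
        ≡⟨ cong (∑ (λ u → ∑ (c u)) +_) (*-distribˡ-sum 2 (λ u → ∑ (far u))) ⟩
      ∑ (λ u → ∑ (c u)) + ∑ (λ u → 2 * ∑ (far u))
        ≡⟨ ∑-distrib-+ (λ u → ∑ (c u)) (λ u → 2 * ∑ (far u)) ⟨
      ∑ (λ u → ∑ (c u) + 2 * ∑ (far u))
        ≡⟨ sum-cong-≗ (λ u → cong (∑ (c u) +_) (*-distribˡ-sum 2 (far u))) ⟩
      ∑ (λ u → ∑ (c u) + ∑ (λ w → 2 * far u w))
        ≡⟨ sum-cong-≗ (λ u → ∑-distrib-+ (c u) (λ w → 2 * far u w)) ⟨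
      ∑ (λ u → ∑ (h u))                                        ∎

  ball-suc : ∀ k → ballSize (suc k) ≡ ballSize k + levelSize (suc k)
  ball-suc k = trans (sum-cong-≗ λ u → 𝟙-<ᵇ-suc (f u) (suc k))
                     (∑-distrib-+ (λ u → 𝟙 (f u <ᵇ suc k)) (λ u → 𝟙 (f u ≡ᵇ suc k)))

  ball-<n : ∀ k w → k < f w → ballSize k < n
  ball-<n k w k<fw = begin-strict
    ballSize k                               <⟨ m<m+n (ballSize k) (s≤s z≤n) ⟩
    ballSize k + 1                           ≡⟨ cong (ballSize k +_) (∑-δ w) ⟨
    ballSize k + ∑ (δ w)                     ≡⟨ ∑-distrib-+ (λ u → 𝟙 (f u <ᵇ suc k)) (δ w) ⟨
    ∑ (λ u → 𝟙 (f u <ᵇ suc k) + δ w u)       ≤⟨ ∑-mono ≤1 ⟩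
    ∑ {n} (λ _ → 1)                          ≡⟨ trans (∑-const n 1) (*-identityʳ n) ⟩
    n                                        ∎
    where
    open ≤-Reasoning
    outside : ∀ j k → k < j → 𝟙 (j <ᵇ suc k) ≡ 0
    outside (suc j) zero    _         = refl
    outside (suc j) (suc k) (s≤s k<j) = outside j k k<j
    ≤1 : ∀ u → 𝟙 (f u <ᵇ suc k) + δ w u ≤ 1
    ≤1 u with w ≟ᶠ u
    ... | yes refl rewrite outside (f w) k k<fw = ≤-refl
    ... | no  _ with f u <ᵇ suc k
    ...   | true  = ≤-refl
    ...   | false = z≤n

  ball-all : ∀ k → (∀ u → f u ≤ k) → ballSize k ≡ n
  ball-all k f≤k =
    trans (sum-cong-≗ λ u → 𝟙-true (<⇒<ᵇ (s≤s (f≤k u)))) (trans (∑-const n 1) (*-identityʳ n))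

  -- The hypotheses are those met by the distances from a vertex of a κ-connected digraph. The last
  -- occupied level may be thin.
  module Layered (κ : ℕ) (1≤κ : 1 ≤ κ) (oneRoot : levelSize 0 ≡ 1)
    (thick : ∀ i w → 0 < i → i < f w → κ ≤ levelSize i) where

    ball-0 : ballSize 0 ≡ 1
    ball-0 = trans (sum-cong-≗ λ u → 𝟙-<ᵇ-suc (f u) 0) oneRoot

    ball-inside : ∀ k w → k < f w → suc (κ * k) ≤ ballSize k
    ball-inside zero    w _ rewrite *-zeroʳ κ = ≤-reflexive (sym ball-0)
    ball-inside (suc k) w k<fw = begin
      suc (κ * suc k)                       ≡⟨ cong suc (trans (*-suc κ k) (+-comm κ (κ * k))) ⟩
      suc (κ * k) + κ                       ≤⟨ +-mono-≤ (ball-inside k w (<-trans (n<1+n k) k<fw))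
                                                        (thick (suc k) w (s≤s z≤n) k<fw) ⟩
      ballSize k + levelSize (suc k)        ≡⟨ ball-suc k ⟨
      ballSize (suc k)                      ∎
      where open ≤-Reasoning

    -- Either some vertex lies beyond level `k`, and all levels up to `k` are inner ones, or the
    -- ball is the whole vertex set.
    ball-≥ : ∀ k → suc (κ * k) ≤ n → suc (κ * k) ≤ ballSize k
    ball-≥ k 1+κk≤n with any? (λ w → k <? f w)
    ... | yes (w , k<fw) = ball-inside k w k<fw
    ... | no  none       = subst (suc (κ * k) ≤_) (sym (ball-all k λ u → ≮⇒≥ λ k<fu → none (u , k<fu))) 1+κk≤n

    positive : suc (∑ λ u → 𝟙 (0 <ᵇ f u)) ≡ n
    positive = begin
      1 + ∑ (λ u → 𝟙 (0 <ᵇ f u))                      ≡⟨ cong (_+ ∑ (λ u → 𝟙 (0 <ᵇ f u))) oneRoot ⟨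
      levelSize 0 + ∑ (λ u → 𝟙 (0 <ᵇ f u))
        ≡⟨ ∑-distrib-+ (λ u → 𝟙 (f u ≡ᵇ 0)) (λ u → 𝟙 (0 <ᵇ f u)) ⟨
      ∑ (λ u → 𝟙 (f u ≡ᵇ 0) + 𝟙 (0 <ᵇ f u))           ≡⟨ sum-cong-≗ (λ u → either (f u)) ⟩
      ∑ {n} (λ _ → 1)                                 ≡⟨ trans (∑-const n 1) (*-identityʳ n) ⟩
      n                                               ∎
      where
      open ≡-Reasoning
      either : ∀ j → 𝟙 (j ≡ᵇ 0) + 𝟙 (0 <ᵇ j) ≡ 1
      either zero    = refl
      either (suc j) = refl

    -- `thick` does not apply if level 1 is the last level, but then it contains all vertices except
    -- the root. `ball-≥` covers both cases.
    level-1 : suc κ ≤ n → κ ≤ levelSize 1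
    level-1 1+κ≤n = +-cancelˡ-≤ 1 _ _ (begin
      1 + κ                       ≡⟨ cong suc (*-identityʳ κ) ⟨
      suc (κ * 1)                 ≤⟨ ball-≥ 1 (subst (λ x → suc x ≤ n) (sym (*-identityʳ κ)) 1+κ≤n) ⟩
      ballSize 1                  ≡⟨ ball-suc 0 ⟩
      ballSize 0 + levelSize 1    ≡⟨ cong (_+ levelSize 1) ball-0 ⟩
      1 + levelSize 1             ∎)
      where open ≤-Reasoning

    -- A vertex on level j ≥ 2 is far from the whole ball of radius j - 2.
    far-from : ∀ w → κ * f w + (𝟙 (0 <ᵇ f w) + (κ ∸ 1) * 𝟙 (f w ≡ᵇ 1))
                     ≤ ∑ (λ u → 𝟙 (suc (f u) <ᵇ f w)) + 2 * κ * 𝟙 (0 <ᵇ f w)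
    far-from w with f w | ball-inside (f w ∸ 2) w
    ... | zero        | _ rewrite *-zeroʳ κ | *-zeroʳ (κ ∸ 1) = z≤n
    ... | suc zero    | _ = begin
      κ * 1 + (1 + (κ ∸ 1) * 1)
        ≡⟨ cong₂ _+_ (*-identityʳ κ) (cong suc (*-identityʳ (κ ∸ 1))) ⟩
      κ + (1 + (κ ∸ 1))                           ≡⟨ cong (κ +_) (m+[n∸m]≡n 1≤κ) ⟩
      κ + κ                                       ≡⟨ double κ ⟩
      2 * κ * 1                                   ≤⟨ m≤n+m (2 * κ * 1) _ ⟩
      ∑ {n} (λ u → 𝟙 (suc (f u) <ᵇ 1)) + 2 * κ * 1 ∎
      where
      open ≤-Reasoning
      double : ∀ k → k + k ≡ 2 * k * 1
      double = solve-∀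
    ... | suc (suc j) | inside = begin
      κ * suc (suc j) + (1 + (κ ∸ 1) * 0)
        ≡⟨ cong (λ x → κ * suc (suc j) + suc x) (*-zeroʳ (κ ∸ 1)) ⟩
      κ * suc (suc j) + 1                         ≡⟨ expand κ j ⟩
      suc (κ * j) + 2 * κ * 1                     ≤⟨ +-monoˡ-≤ (2 * κ * 1) (inside (n≤1+n (suc j))) ⟩
      ballSize j + 2 * κ * 1                      ∎
      where
      open ≤-Reasoning
      expand : ∀ k j → k * suc (suc j) + 1 ≡ suc (k * j) + 2 * k * 1
      expand = solve-∀

    -- Sum of `far-from` over all `w`. On level 1 the expression `1 + κ (f w - 2)` is `1 - κ`, while
    -- no vertex is far below; this deficit of `κ - 1` is claimed for each of the at least κ
    -- vertices of level 1, which gives `(κ ∸ 1) * κ`.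
    farPairs-≥ : suc κ ≤ n → κ * ∑ f + ((n ∸ 1) + (κ ∸ 1) * κ) ≤ farPairs + 2 * κ * (n ∸ 1)
    farPairs-≥ 1+κ≤n = begin
      κ * ∑ f + ((n ∸ 1) + (κ ∸ 1) * κ)
        ≤⟨ +-monoʳ-≤ (κ * ∑ f) (+-monoʳ-≤ (n ∸ 1) (*-monoʳ-≤ (κ ∸ 1) (level-1 1+κ≤n))) ⟩
      κ * ∑ f + ((n ∸ 1) + (κ ∸ 1) * levelSize 1)
        ≡⟨ cong (λ x → κ * ∑ f + (x + (κ ∸ 1) * levelSize 1)) N≡ ⟩
      κ * ∑ f + (∑ nonRoot + (κ ∸ 1) * levelSize 1)
        ≡⟨ cong₂ (λ x y → x + (∑ nonRoot + y)) (*-distribˡ-sum κ f) (*-distribˡ-sum (κ ∸ 1) one) ⟩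
      ∑ (λ w → κ * f w) + (∑ nonRoot + ∑ (λ w → (κ ∸ 1) * one w))
        ≡⟨ cong (∑ (λ w → κ * f w) +_) (∑-distrib-+ nonRoot (λ w → (κ ∸ 1) * one w)) ⟨
      ∑ (λ w → κ * f w) + ∑ (λ w → nonRoot w + (κ ∸ 1) * one w)
        ≡⟨ ∑-distrib-+ (λ w → κ * f w) (λ w → nonRoot w + (κ ∸ 1) * one w) ⟨
      ∑ (λ w → κ * f w + (nonRoot w + (κ ∸ 1) * one w))              ≤⟨ ∑-mono far-from ⟩
      ∑ (λ w → ∑ (λ u → far u w) + 2 * κ * nonRoot w)
        ≡⟨ ∑-distrib-+ (λ w → ∑ (λ u → far u w)) (λ w → 2 * κ * nonRoot w) ⟩
      ∑ (λ w → ∑ (λ u → far u w)) + ∑ (λ w → 2 * κ * nonRoot w)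
        ≡⟨ cong₂ _+_ (∑-comm far) (*-distribˡ-sum (2 * κ) nonRoot) ⟨
      farPairs + 2 * κ * ∑ nonRoot
        ≡⟨ cong (λ x → farPairs + 2 * κ * x) N≡ ⟨
      farPairs + 2 * κ * (n ∸ 1)                                 ∎
      where
      open ≤-Reasoning
      nonRoot one : Fin n → ℕ
      nonRoot w = 𝟙 (0 <ᵇ f w)
      one w = 𝟙 (f w ≡ᵇ 1)
      far : Fin n → Fin n → ℕ
      far u w = 𝟙 (suc (f u) <ᵇ f w)
      N≡ : n ∸ 1 ≡ ∑ nonRoot
      N≡ = cong (_∸ 1) (sym positive)

    ∑-∸-suc : ∀ L → ∑ (λ u → suc L ∸ f u) ≡ ∑ (λ u → L ∸ f u) + ballSize L
    ∑-∸-suc L = trans (sum-cong-≗ λ u → ∸-𝟙 L (f u)) (∑-distrib-+ (λ u → L ∸ f u) (λ u → 𝟙 (f u <ᵇ suc L)))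

    -- Summation by parts: by `∑-∸-suc` the sum on the right is that of the ball sizes for radii 0
    -- to `L`, and the ball of radius `i` has at least `1 + κ * i` vertices. Doubling avoids the
    -- division in the triangular number.
    ∑-∸-≥ : ∀ L → suc (κ * L) ≤ n → 2 * suc L + κ * (suc L * L) ≤ 2 * ∑ (λ u → suc L ∸ f u)
    ∑-∸-≥ zero    1≤n = begin
      2 + κ * 0                           ≡⟨ cong (2 +_) (*-zeroʳ κ) ⟩
      2 * 1                               ≡⟨ cong (2 *_) ball-0 ⟨
      2 * ballSize 0                      ≤⟨ *-monoʳ-≤ 2 (m≤n+m (ballSize 0) (∑ (λ u → 0 ∸ f u))) ⟩
      2 * (∑ (λ u → 0 ∸ f u) + ballSize 0) ≡⟨ cong (2 *_) (∑-∸-suc 0) ⟨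
      2 * ∑ (λ u → 1 ∸ f u)               ∎
      where open ≤-Reasoning
    ∑-∸-≥ (suc L) 1+κL≤n = begin
      2 * suc (suc L) + κ * (suc (suc L) * suc L)              ≡⟨ expand κ L ⟩
      (2 * suc L + κ * (suc L * L)) + 2 * suc (κ * suc L)
        ≤⟨ +-mono-≤ (∑-∸-≥ L (≤-trans (s≤s (*-monoʳ-≤ κ (n≤1+n L))) 1+κL≤n))
                                                                           (*-monoʳ-≤ 2 (ball-≥ (suc L) 1+κL≤n)) ⟩
      2 * ∑ (λ u → suc L ∸ f u) + 2 * ballSize (suc L)
        ≡⟨ *-distribˡ-+ 2 (∑ (λ u → suc L ∸ f u)) (ballSize (suc L)) ⟨
      2 * (∑ (λ u → suc L ∸ f u) + ballSize (suc L))           ≡⟨ cong (2 *_) (∑-∸-suc (suc L)) ⟨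
      2 * ∑ (λ u → suc (suc L) ∸ f u)                          ∎
      where
      open ≤-Reasoning
      expand : ∀ k L → 2 * suc (suc L) + k * (suc (suc L) * suc L)
                       ≡ (2 * suc L + k * (suc L * L)) + 2 * suc (k * suc L)
      expand = solve-∀

    -- Once no vertex lies beyond level `suc L`, the sums of `f u` and of `suc L ∸ f u` add up to
    -- `n * suc L`, and `∑-∸-≥` bounds the second from below.
    ∑-≤ : ∀ L b → 1 ≤ b → b ≤ κ → n ≡ suc (κ * L + b) → 2 * ∑ f ≤ κ * (suc L * L) + 2 * (suc L * b)
    ∑-≤ L b 1≤b b≤κ n≡ = +-cancelʳ-≤ (2 * suc L + κ * (suc L * L)) _ _ (begin
      2 * ∑ f + (2 * suc L + κ * (suc L * L))                  ≤⟨ +-monoʳ-≤ (2 * ∑ f) (∑-∸-≥ L 1+κL≤n) ⟩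
      2 * ∑ f + 2 * ∑ (λ u → suc L ∸ f u)
        ≡⟨ *-distribˡ-+ 2 (∑ f) (∑ (λ u → suc L ∸ f u)) ⟨
      2 * (∑ f + ∑ (λ u → suc L ∸ f u))
        ≡⟨ cong (2 *_) (∑-distrib-+ f (λ u → suc L ∸ f u)) ⟨
      2 * ∑ (λ u → f u + (suc L ∸ f u))
        ≡⟨ cong (2 *_) (sum-cong-≗ λ u → m+[n∸m]≡n (f≤ u)) ⟩
      2 * ∑ {n} (λ _ → suc L)                                  ≡⟨ cong (2 *_) (∑-const n (suc L)) ⟩
      2 * (n * suc L)                                          ≡⟨ cong (λ x → 2 * (x * suc L)) n≡ ⟩
      2 * (suc (κ * L + b) * suc L)                            ≡⟨ expand κ L b ⟩
      κ * (suc L * L) + 2 * (suc L * b) + (2 * suc L + κ * (suc L * L)) ∎)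
      where
      open ≤-Reasoning
      expand : ∀ k L b → 2 * (suc (k * L + b) * suc L)
                         ≡ k * (suc L * L) + 2 * (suc L * b) + (2 * suc L + k * (suc L * L))
      expand = solve-∀
      1+κL≤n : suc (κ * L) ≤ n
      1+κL≤n = subst (suc (κ * L) ≤_) (sym n≡) (s≤s (m≤m+n (κ * L) b))
      f≤ : ∀ u → f u ≤ suc L
      -- A vertex beyond level `suc L` would make levels 1 to `suc L` inner ones; with the root they
      -- already have at least `n` vertices, leaving none for it.
      f≤ u = ≮⇒≥ λ L<fu → <-irrefl refl (begin-strict
        κ * suc L + 1        ≡⟨ +-comm _ 1 ⟩
        suc (κ * suc L)      ≤⟨ ball-inside (suc L) u L<fu ⟩
        ballSize (suc L)     <⟨ ball-<n (suc L) u L<fu ⟩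
        n                    ≡⟨ n≡ ⟩
        suc (κ * L + b)      ≤⟨ s≤s (+-monoʳ-≤ (κ * L) b≤κ) ⟩
        suc (κ * L + κ)      ≡⟨ lemma κ L ⟩
        κ * suc L + 1        ∎)
        where
        lemma : ∀ k L → suc (k * L + k) ≡ k * suc L + 1
        lemma = solve-∀

-- Distance levels of Eulerian digraphs

least-≤ : ∀ (P : ℕ → Bool) n k → P k ≡ true → least P n ≤ k
least-≤ P zero    k       _  = z≤n
least-≤ P (suc n) zero    eq rewrite eq = z≤n
least-≤ P (suc n) (suc k) eq with P zero
... | true  = z≤n
... | false = s≤s (least-≤ (P ∘ suc) n k eq)

arc⇒≢ : ∀ (D : Digraph) {u w} → T (Digraph.arc D u w) → u ≢ w
arc⇒≢ D {u} a refl = subst T (Digraph.loopless D u) a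

module _ {D : Digraph} where
  open Digraph D

  _∷ʳ_ : ∀ {u v w} → Walk D u v → T (arc v w) → Walk D u w
  []      ∷ʳ a = a ∷ []
  (b ∷ p) ∷ʳ a = b ∷ (p ∷ʳ a)

  walkLength-∷ʳ : ∀ {u v w} (p : Walk D u v) (a : T (arc v w)) → walkLength (p ∷ʳ a) ≡ suc (walkLength p)
  walkLength-∷ʳ []      a = refl
  walkLength-∷ʳ (b ∷ p) a = cong suc (walkLength-∷ʳ p a)

  length-walkArcs : ∀ {u v} (p : Walk D u v) → length (walkArcs p) ≡ walkLength p
  length-walkArcs []      = refl
  length-walkArcs (_ ∷ p) = cong suc (length-walkArcs p)

  dist-≤ : ∀ {u v} (p : Walk D u v) → dist D u v ≤ walkLength p
  dist-≤ {u} {v} p = least-≤ _ order (walkLength p)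
    (dec-true (walkOfLength? D (walkLength p) u v) (p , refl))

module _ (D : Digraph) where
  open Digraph D

  length-⊆-size : ∀ {es} → (∀ u w → T (arc u w) → (u , w) ∈ es) → size ≤ length es
  length-⊆-size {es} all∈ =
    length-⊆ unique λ {e} e∈ → all∈ _ _ (proj₂ (∈-filter⁻ (T? ∘ uncurry arc) {v = e} {xs = pairs order} e∈))
    where
    unique : Unique arcs
    unique = filter⁺ (T? ∘ uncurry arc) (cartesianProduct⁺ (allFin⁺ order) (allFin⁺ order))

  -- The vertices of `removeVertices D S` are the indices of this list.
  kept : Subset order → List Vertex
  kept S = filter (λ v → ¬? (v ∈? S)) (allFin order)

  kept-∉ : ∀ S i → lookup (kept S) i ∉ˢ S
  kept-∉ S i = proj₂ (∈-filter⁻ (λ v → ¬? (v ∈? S)) {xs = allFin order} (∈-lookup {xs = kept S} i))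

  kept-index : ∀ S {u} → u ∉ˢ S → ∃[ i ] lookup (kept S) i ≡ u
  kept-index S {u} u∉S = index u∈ , sym (lookup-index u∈)
    where
    u∈ : u ∈ kept S
    u∈ = ∈-filter⁺ (λ v → ¬? (v ∈? S)) (∈-allFin u) u∉S

  module Potential (f : Vertex → ℕ) (step : ∀ {u w} → T (arc u w) → f w ≤ suc (f u)) where

    -- Subtracting `δ` discards the diagonal pairs, to which `cost` gives 1 although no arc is a
    -- loop.
    excess : Vertex × Vertex → ℕ
    excess (u , w) = cost (f u) (f w) ∸ δ u w

    -- `cost-step` summed along the walk; the values of `f` at inner vertices telescope.
    walkLength-≤ : ∀ {u w} (p : Walk D u w) → walkLength p + f w ≤ sumᴸ (map excess (walkArcs p)) + f u
    walkLength-≤ []                              = ≤-refl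
    walkLength-≤ {u} {w} (_∷_ {v = x} a p) = begin
      suc (walkLength p) + f w                          ≤⟨ s≤s (walkLength-≤ p) ⟩
      suc (rest + f x)                                  ≡⟨ +-suc rest (f x) ⟨
      rest + (1 + f x)                                  ≤⟨ +-monoʳ-≤ rest (cost-step (f u) (f x) (step a)) ⟩
      rest + (cost (f u) (f x) + f u)
        ≡⟨ cong (λ d → rest + (cost (f u) (f x) ∸ d + f u)) (δ-≢ (arc⇒≢ D a)) ⟨
      rest + (excess (u , x) + f u)                     ≡⟨ rearrange rest (excess (u , x)) (f u) ⟩
      excess (u , x) + rest + f u                       ∎
      where
      open ≤-Reasoning
      rest = sumᴸ (map excess (walkArcs p))
      rearrange : ∀ p q r → p + (q + r) ≡ q + p + r
      rearrange = solve-∀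

    -- The circuit is closed, so the two end values of `f` in `walkLength-≤` cancel. Its arcs are
    -- distinct, so their excess is at most that of all ordered pairs, which `∑-cost` evaluates.
    size-≤ : Eulerian D → size + order + 2 * farPairs f ≤ order * order
    size-≤ (_ , v , p , unique , covers) = begin
      size + order + 2 * farPairs f
        ≤⟨ +-monoˡ-≤ _ (+-monoˡ-≤ order size≤excess) ⟩
      ∑ (λ u → ∑ λ w → excess (u , w)) + order + 2 * farPairs f
        ≡⟨ cong (_+ 2 * farPairs f) excess+order ⟩
      ∑ (λ u → ∑ λ w → cost (f u) (f w)) + 2 * farPairs f               ≡⟨ ∑-cost f ⟩
      order * order                                                     ∎
      where
      open ≤-Reasoning
      size≤excess : size ≤ ∑ (λ u → ∑ λ w → excess (u , w))
      size≤excess = begin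
        size                                      ≤⟨ length-⊆-size covers ⟩
        length (walkArcs p)                       ≡⟨ length-walkArcs p ⟩
        walkLength p                              ≤⟨ +-cancelʳ-≤ (f v) _ _ (walkLength-≤ p) ⟩
        sumᴸ (map excess (walkArcs p))            ≤⟨ sum-⊆ excess unique (λ {e} _ → ∈-pairs e) ⟩
        sumᴸ (map excess (pairs order))           ≡⟨ sum-pairs excess ⟩
        ∑ (λ u → ∑ λ w → excess (u , w))          ∎
      δ≤cost : ∀ u w → δ u w ≤ cost (f u) (f w)
      δ≤cost u w with u ≟ᶠ w
      ... | yes refl = ≤-reflexive (sym (cost-refl (f u)))
      ... | no  _    = z≤n
      row : ∀ u → ∑ (λ w → excess (u , w)) + 1 ≡ ∑ (λ w → cost (f u) (f w))
      row u = begin-equality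
        ∑ (λ w → excess (u , w)) + 1              ≡⟨ cong (∑ (λ w → excess (u , w)) +_) (∑-δ u) ⟨
        ∑ (λ w → excess (u , w)) + ∑ (δ u)        ≡⟨ ∑-distrib-+ (λ w → excess (u , w)) (δ u) ⟨
        ∑ (λ w → excess (u , w) + δ u w)          ≡⟨ sum-cong-≗ (λ w → m∸n+n≡m (δ≤cost u w)) ⟩
        ∑ (λ w → cost (f u) (f w))                ∎
      excess+order : ∑ (λ u → ∑ λ w → excess (u , w)) + order ≡ ∑ (λ u → ∑ λ w → cost (f u) (f w))
      excess+order = begin-equality
        ∑ (λ u → ∑ λ w → excess (u , w)) + order
          ≡⟨ cong (∑ (λ u → ∑ λ w → excess (u , w)) +_) (trans (∑-const order 1) (*-identityʳ order)) ⟨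
        ∑ (λ u → ∑ λ w → excess (u , w)) + ∑ {order} (λ _ → 1)
          ≡⟨ ∑-distrib-+ (λ u → ∑ λ w → excess (u , w)) (λ _ → 1) ⟨
        ∑ (λ u → ∑ (λ w → excess (u , w)) + 1)
          ≡⟨ sum-cong-≗ row ⟩
        ∑ (λ u → ∑ λ w → cost (f u) (f w)) ∎

    -- Level `i` is itself a cut: without it `v`, which lies below, cannot reach `w`, which lies
    -- above.
    level-cut : ∀ {κ} → Connected κ D → ∀ {v w} i → f v < i → i < f w → κ ≤ levelSize f i
    level-cut {κ} conn {v} {w} i fv<i i<fw = subst (κ ≤_) ∣S∣ (conn S disconnected)
      where
      S : Subset order
      S = Vec.tabulate λ u → f u ≡ᵇ i
      ∣S∣ : ∣ S ∣ ≡ levelSize f i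
      ∣S∣ = trans (∣∣-∑ S) (sum-cong-≗ λ u → cong 𝟙 (lookup∘tabulate (λ u → f u ≡ᵇ i) u))
      ∉S : ∀ {u} → f u ≢ i → u ∉ˢ S
      ∉S {u} fu≢i u∈S = fu≢i (≡ᵇ⇒≡ (f u) i (subst T (trans (sym ([]=⇒lookup u∈S)) (lookup∘tabulate _ u)) _))
      ∈S : ∀ {u} → f u ≡ i → u ∈ˢ S
      ∈S {u} refl = lookup⇒[]= u S (trans (lookup∘tabulate _ u) (T⇒true (≡⇒≡ᵇ (f u) (f u) refl)))
        where
        T⇒true : ∀ {b} → T b → b ≡ true
        T⇒true {true} _ = refl
      g : Fin (length (kept S)) → ℕ
      g j = f (lookup (kept S) j)
      -- An arc climbs at most one level, so a walk could pass level `i` only by meeting it, and its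
      -- vertices are gone.
      stays : ∀ {j k} → Walk (removeVertices D S) j k → g j < i → g k < i
      stays []                gj<i = gj<i
      stays (_∷_ {v = j} a p) gj<i =
        stays p (≤∧≢⇒< (≤-trans (step a) gj<i) λ eq → kept-∉ S j (∈S eq))
      disconnected : ¬ Strong (removeVertices D S)
      disconnected strong with kept-index S (∉S (<⇒≢ fv<i)) | kept-index S (∉S (≢-sym (<⇒≢ i<fw)))
      ... | j , refl | k , refl = <-asym i<fw (stays (proj₁ (strong j k)) fv<i)

  module Distances (strong : Strong D) (v : Vertex) where

    -- A shortest path to `u` followed by the arc need not be a path, but `dist-≤` bounds the
    -- distance by the length of any walk.
    dist-step : ∀ {u w} → T (arc u w) → dist D v w ≤ suc (dist D v u)
    dist-step {u} {w} a with dist-correct D (strong v u)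
    ... | ((p , _) , len) , _ = ≤-trans (dist-≤ (p ∷ʳ a)) (≤-reflexive (trans (walkLength-∷ʳ p a) (cong suc len)))

    dist-self : dist D v v ≡ 0
    dist-self = n≤0⇒n≡0 (dist-≤ {D} {v} [])

    dist-0 : ∀ {w} → dist D v w ≡ 0 → v ≡ w
    dist-0 {w} d≡0 with dist-correct D (strong v w)
    ... | (([] , _) , _) , _        = refl
    ... | ((_ ∷ _ , _) , len) , _   = contradiction (trans len d≡0) λ ()

    oneRoot : levelSize (dist D v) 0 ≡ 1
    oneRoot = trans (sum-cong-≗ root) (∑-δ v)
      where
      root : ∀ w → 𝟙 (dist D v w ≡ᵇ 0) ≡ δ v w
      root w with v ≟ᶠ w
      ... | yes refl rewrite dist-self = refl
      ... | no  v≢w with dist D v w in eq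
      ...   | zero  = contradiction (dist-0 eq) v≢w
      ...   | suc _ = refl

totalDistance : (D : Digraph) → Digraph.Vertex D → ℕ
totalDistance D v = ∑ (dist D v)

module Bounds {κ} (1≤κ : 1 ≤ κ) (D : Digraph) (conn : Connected κ D) (euler : Eulerian D) (v : Digraph.Vertex D) where
  open Digraph D
  open Distances D (proj₁ euler) v
  open Potential D (dist D v) dist-step

  thick : ∀ i w → 0 < i → i < dist D v w → κ ≤ levelSize (dist D v) i
  thick i w 0<i i<d = level-cut conn i (subst (_< i) (sym dist-self) 0<i) i<d

  open Layered (dist D v) κ 1≤κ oneRoot thick public using (∑-≤)
  open Layered (dist D v) κ 1≤κ oneRoot thick using (farPairs-≥)

  totalDistance-size : ∀ {N} → order ≡ suc N → κ ≤ N →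
    2 * κ * totalDistance D v + size + suc N + 2 * κ * κ ≤ N * N + 4 * κ * N + 1 + 2 * κ
  -- Twice the lower bound for `farPairs` is added to the upper bound for size plus `2 * farPairs`;
  -- the terms with `farPairs` then cancel.
  totalDistance-size {N} order≡ κ≤N = +-cancelʳ-≤ (2 * N + 2 * farPairs (dist D v)) _ _ (begin
    2 * κ * σ + size + suc N + 2 * κ * κ + (2 * N + 2 * F)
      ≡⟨ regroup κ (κ ∸ 1) σ size N F (m+[n∸m]≡n 1≤κ) ⟩
    2 * (κ * σ + (N + (κ ∸ 1) * κ)) + (size + suc N + 2 * F) + 2 * κ
      ≤⟨ +-monoˡ-≤ (2 * κ) (+-mono-≤ (*-monoʳ-≤ 2 far) sizeBound) ⟩
    2 * (F + 2 * κ * N) + suc N * suc N + 2 * κ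
      ≡⟨ final κ N F ⟩
    N * N + 4 * κ * N + 1 + 2 * κ + (2 * N + 2 * F) ∎)
    where
    open ≤-Reasoning
    σ = totalDistance D v
    F = farPairs (dist D v)
    far : κ * σ + (N + (κ ∸ 1) * κ) ≤ F + 2 * κ * N
    far = subst (λ m → κ * σ + (m + (κ ∸ 1) * κ) ≤ F + 2 * κ * m) (cong (_∸ 1) order≡)
            (farPairs-≥ (subst (suc κ ≤_) (sym order≡) (s≤s κ≤N)))
    sizeBound : size + suc N + 2 * F ≤ suc N * suc N
    sizeBound = subst (λ m → size + m + 2 * F ≤ m * m) order≡ (size-≤ euler)
    regroup : ∀ k k′ s z N F → suc k′ ≡ k →
      2 * k * s + z + suc N + 2 * k * k + (2 * N + 2 * F) ≡ 2 * (k * s + (N + k′ * k)) + (z + suc N + 2 * F) + 2 * k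
    regroup _ k′ s z N F refl = identity k′ s z N F
      where
      identity : ∀ k s z N F →
        2 * suc k * s + z + suc N + 2 * suc k * suc k + (2 * N + 2 * F)
        ≡ 2 * (suc k * s + (N + k * suc k)) + (z + suc N + 2 * F) + 2 * suc k
      identity = solve-∀
    final : ∀ k N F → 2 * (F + 2 * k * N) + suc N * suc N + 2 * k
      ≡ N * N + 4 * k * N + 1 + 2 * k + (2 * N + 2 * F)
    final = solve-∀

-- Eulerian circuits of symmetric digraphs

module _ {D : Digraph} where
  open Digraph D

  walkSuffix : ∀ {u v w} (p : Walk D v w) → Unique (walkVertices p) → u ∈ walkVertices p → Path D u w
  walkSuffix []      un       (here refl) = [] , un
  walkSuffix (a ∷ p) un       (here refl) = a ∷ p , un
  walkSuffix (a ∷ p) (_ ∷ un) (there u∈p) = walkSuffix p un u∈p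

  walk⇒path : ∀ {u v} → Walk D u v → Path D u v
  walk⇒path []                = [] , [] ∷ []
  walk⇒path (_∷_ {u = u} a p) with walk⇒path p
  ... | q , un with DecMembership._∈?_ _≟ᶠ_ u (walkVertices q)
  ...   | no  u∉q = a ∷ q , ¬Any⇒All¬ _ u∉q ∷ un
  ...   | yes u∈q = walkSuffix q un u∈q

  arc-source : ∀ {u v x y} (p : Walk D u v) → (x , y) ∈ walkArcs p → x ∈ walkVertices p
  arc-source (_ ∷ p) (here refl) = here refl
  arc-source (_ ∷ p) (there e∈p) = there (arc-source p e∈p)

  -- The detour from `u` to `w` and back is spliced in at a visit to `u`.
  insert : ∀ {a b u w} (p : Walk D a b) → u ∈ walkVertices p → T (arc u w) → T (arc w u) →
           Σ (Walk D a b) λ q → walkArcs q ↭ (u , w) ∷ (w , u) ∷ walkArcs p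
  insert []      (here refl) uw wu = uw ∷ wu ∷ [] , ↭-refl
  insert (e ∷ p) (here refl) uw wu = uw ∷ wu ∷ e ∷ p , ↭-refl
  insert (e ∷ p) (there u∈p) uw wu with insert p u∈p uw wu
  ... | q , perm = e ∷ q , ↭-trans (prep _ perm) (↭-trans (swap _ _ ↭-refl) (prep _ (swap _ _ ↭-refl)))

  -- Following a walk from a vertex of the trail to an unused arc, the first
  -- unused arc met starts on the trail.
  attachedArc : ∀ {a b z x y} (p : Walk D a b) → (∀ {e f} → (e , f) ∈ walkArcs p → (f , e) ∈ walkArcs p) →
                z ∈ walkVertices p → Walk D z x → T (arc x y) → (x , y) ∉ walkArcs p →
                ∃[ u ] ∃[ w ] u ∈ walkVertices p × T (arc u w) × (u , w) ∉ walkArcs p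
  attachedArc p symm z∈p []                         xy xy∉p = _ , _ , z∈p , xy , xy∉p
  attachedArc p symm z∈p (_∷_ {u = z} {v = z′} a r) xy xy∉p
    with DecMembership._∈?_ (≡-dec _≟ᶠ_ _≟ᶠ_) (z , z′) (walkArcs p)
  ... | no  zz′∉p = z , z′ , z∈p , a , zz′∉p
  ... | yes zz′∈p = attachedArc p symm (arc-source p (symm zz′∈p)) r xy xy∉p

module SymmetricEulerian (D : Digraph) (symmetric : ∀ u w → Digraph.arc D u w ≡ Digraph.arc D w u)
  (strong : Strong D) (v : Digraph.Vertex D) where
  open Digraph D

  reverseArc : ∀ {u w} → T (arc u w) → T (arc w u)
  reverseArc {u} {w} = subst T (symmetric u w)

  record SymmetricTrail : Set where
    field
      walk   : Walk D v v
      unique : Unique (walkArcs walk)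
      symm   : ∀ {u w} → (u , w) ∈ walkArcs walk → (w , u) ∈ walkArcs walk
  open SymmetricTrail

  start∈ : ∀ {w} (p : Walk D v w) → v ∈ walkVertices p
  start∈ []      = here refl
  start∈ (_ ∷ _) = here refl

  extend : ∀ t {u w} → u ∈ walkVertices (walk t) → T (arc u w) → (u , w) ∉ walkArcs (walk t) →
           Σ SymmetricTrail λ t′ → length (walkArcs (walk t′)) ≡ 2 + length (walkArcs (walk t))
  extend t {u} {w} u∈t a uw∉t with insert (walk t) u∈t a (reverseArc a)
  ... | q , perm = record { walk = q ; unique = unique′ ; symm = symm′ } , ↭-length perm
    where
    uw≢wu : (u , w) ≢ (w , u)
    uw≢wu eq = arc⇒≢ D a (cong proj₁ eq)
    unique′ : Unique (walkArcs q)
    unique′ = Unique-resp-↭ (setoid _) (↭⇒↭ₛ (↭-sym perm))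
      ((uw≢wu ∷ ¬Any⇒All¬ _ uw∉t) ∷ ¬Any⇒All¬ _ (uw∉t ∘ symm t) ∷ unique t)
    symm″ : ∀ {x y} → (x , y) ∈ (u , w) ∷ (w , u) ∷ walkArcs (walk t) →
            (y , x) ∈ (u , w) ∷ (w , u) ∷ walkArcs (walk t)
    symm″ (here refl)         = there (here refl)
    symm″ (there (here refl)) = here refl
    symm″ (there (there e∈t)) = there (there (symm t e∈t))
    symm′ : ∀ {x y} → (x , y) ∈ walkArcs q → (y , x) ∈ walkArcs q
    symm′ e∈q = ∈-resp-↭ (↭-sym perm) (symm″ (∈-resp-↭ perm e∈q))

  -- `k` is fuel. The arcs of a trail are distinct, so there are at most as many as ordered pairs;
  -- an extension spends one unit of fuel and adds two arcs, so the trail covers all arcs before the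
  -- fuel runs out.
  exhaust : ∀ k t → length (pairs order) < k + length (walkArcs (walk t)) →
            Σ (Walk D v v) (IsEulerianCircuit D)
  exhaust zero    t lt = contradiction (length-⊆ (unique t) (λ {e} _ → ∈-pairs e)) (<⇒≱ lt)
  exhaust (suc k) t lt with any? (λ u → any? λ w → T? (arc u w) ×-dec ¬? (DecMembership._∈?_ (≡-dec _≟ᶠ_ _≟ᶠ_) (u , w) (walkArcs (walk t))))
  ... | yes (x , y , xy , xy∉t) with attachedArc (walk t) (symm t) (start∈ (walk t)) (proj₁ (strong v x)) xy xy∉t
  ...   | u , w , u∈t , uw , uw∉t with extend t u∈t uw uw∉t
  ...     | t′ , len = exhaust k t′ (≤-trans lt (≤-trans (≤-reflexive (sym (+-suc k _)))
                         (+-monoʳ-≤ k (≤-trans (n≤1+n _) (≤-reflexive (sym len))))))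
  exhaust (suc k) t lt | no none = walk t , unique t , covers
    where
    covers : ∀ u w → T (arc u w) → (u , w) ∈ walkArcs (walk t)
    covers u w a with DecMembership._∈?_ (≡-dec _≟ᶠ_ _≟ᶠ_) (u , w) (walkArcs (walk t))
    ... | yes e∈t = e∈t
    ... | no  e∉t = contradiction (u , w , a , e∉t) none

  eulerian : Eulerian D
  eulerian =
    strong , v , exhaust (suc (length (pairs order))) (record { walk = [] ; unique = [] ; symm = λ () })
                            (≤-reflexive (sym (+-identityʳ _)))

-- Strong connectivity from levels

module _ (D : Digraph) (f : Digraph.Vertex D → ℕ)
  (close : ∀ {u w} → u ≢ w → f u ≤ suc (f w) → f w ≤ suc (f u) → T (Digraph.arc D u w))
  (dense : ∀ {u w} k → f u < k → k < f w → ∃[ x ] f x ≡ k) where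
  open Digraph D

  consecutive : ∀ {u w} → f w ≡ suc (f u) → T (arc u w) × T (arc w u)
  consecutive {u} {w} eq = close (≢-sym w≢u) u≤w w≤u , close w≢u w≤u u≤w
    where
    u≤w : f u ≤ suc (f w)
    u≤w = m≤n⇒m≤1+n (≤-trans (n≤1+n _) (≤-reflexive (sym eq)))
    w≤u : f w ≤ suc (f u)
    w≤u = ≤-reflexive eq
    w≢u : w ≢ u
    w≢u refl = 1+n≢n (sym eq)

  -- `d` is the number of levels to climb. If `d` is at least 2, `dense` supplies a vertex on the
  -- next level; otherwise `close` gives the arc unless the vertices coincide. The condition in
  -- `close` is symmetric, so the way back is built at the same time.
  climb : ∀ d u w → f w ≡ d + f u → Walk D u w × Walk D w u
  climb zero          u w eq with u ≟ᶠ w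
  ... | yes refl = [] , []
  ... | no  u≢w  = close u≢w u≤w w≤u ∷ [] , close (≢-sym u≢w) w≤u u≤w ∷ []
    where
    u≤w : f u ≤ suc (f w)
    u≤w = m≤n⇒m≤1+n (≤-reflexive (sym eq))
    w≤u : f w ≤ suc (f u)
    w≤u = m≤n⇒m≤1+n (≤-reflexive eq)
  climb (suc zero)    u w eq = let uw , wu = consecutive eq in uw ∷ [] , wu ∷ []
  climb (suc (suc d)) u w eq =
    let x  , fx≡ = dense (suc (f u)) ≤-refl (≤-trans (s≤s (s≤s (m≤n+m (f u) d))) (≤-reflexive (sym eq)))
        ux , xu  = consecutive fx≡
        xw , wx  =
          climb (suc d) x w (trans eq (sym (trans (cong (suc d +_) fx≡) (cong suc (+-suc d (f u))))))
    in ux ∷ xw , wx ∷ʳ xu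

  dense⇒strong : Strong D
  dense⇒strong u w with ≤-total (f u) (f w)
  ... | inj₁ u≤w = walk⇒path (proj₁ (climb (f w ∸ f u) u w (sym (m∸n+n≡m u≤w))))
  ... | inj₂ w≤u = walk⇒path (proj₂ (climb (f u ∸ f w) w u (sym (m∸n+n≡m w≤u))))

-- Sequential sums of complete graphs

open Graph using (order; edge)

size-∑ : ∀ D → Digraph.size D ≡ ∑ λ u → ∑ λ w → 𝟙 (Digraph.arc D u w)
size-∑ D = trans (length-filterᵇ (uncurry arc) (pairs n)) (sum-pairs (𝟙 ∘ uncurry arc))
  where open Digraph D renaming (order to n)

-- `graphSize` counts an edge once, from its smaller end; transposing one of two copies of the sum
-- supplies the other orientation.
2*graphSize : ∀ G → 2 * graphSize G ≡ Digraph.size (bidirected G)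
2*graphSize G = begin
  2 * graphSize G                                               ≡⟨ cong (graphSize G +_) (+-identityʳ _) ⟩
  graphSize G + graphSize G                                     ≡⟨ cong₂ _+_ size≡ size≡ ⟩
  ∑ (λ u → ∑ (up u)) + ∑ (λ u → ∑ (up u))
    ≡⟨ cong (∑ (λ u → ∑ (up u)) +_) (∑-comm up) ⟩
  ∑ (λ u → ∑ (up u)) + ∑ (λ u → ∑ λ w → up w u)
    ≡⟨ ∑-distrib-+ (λ u → ∑ (up u)) (λ u → ∑ λ w → up w u) ⟨
  ∑ (λ u → ∑ (up u) + ∑ λ w → up w u)
    ≡⟨ sum-cong-≗ (λ u → sym (∑-distrib-+ (up u) (λ w → up w u))) ⟩
  ∑ (λ u → ∑ λ w → up u w + up w u)
    ≡⟨ sum-cong-≗ (λ u → sum-cong-≗ (oriented u)) ⟩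
  ∑ (λ u → ∑ λ w → 𝟙 (edge G u w))                              ≡⟨ size-∑ (bidirected G) ⟨
  Digraph.size (bidirected G)                                   ∎
  where
  open ≡-Reasoning
  up : Fin (order G) → Fin (order G) → ℕ
  up u w = 𝟙 ((toℕ u <ᵇ toℕ w) ∧ edge G u w)
  size≡ : graphSize G ≡ ∑ λ u → ∑ (up u)
  size≡ = trans (length-filterᵇ (λ (u , w) → (toℕ u <ᵇ toℕ w) ∧ edge G u w) (pairs (order G)))
                (sum-pairs (λ (u , w) → up u w))
  split : ∀ a b e → a ≢ b → 𝟙 ((a <ᵇ b) ∧ e) + 𝟙 ((b <ᵇ a) ∧ e) ≡ 𝟙 e
  split zero    zero    e a≢b = contradiction refl a≢b
  split zero    (suc b) e a≢b = +-identityʳ (𝟙 e)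
  split (suc a) zero    e a≢b = refl
  split (suc a) (suc b) e a≢b = split a b e (a≢b ∘ cong suc)
  loop : ∀ a b → 𝟙 ((a <ᵇ b) ∧ false) ≡ 0
  loop a b with a <ᵇ b
  ... | true  = refl
  ... | false = refl
  oriented : ∀ u w → up u w + up w u ≡ 𝟙 (edge G u w)
  oriented u w with u ≟ᶠ w
  ... | yes refl rewrite Graph.loopless G u | loop (toℕ u) (toℕ u) = refl
  ... | no  u≢w rewrite Graph.symmetric G w u = split (toℕ u) (toℕ w) (edge G u w) (u≢w ∘ toℕ-injective)

layers : List ℕ → Graph
layers xs = sequentialSum (map complete xs)

headSize : List ℕ → ℕ
headSize xs = headOrder (map complete xs)

-- The index, from 0, of the summand that contains the vertex.
lev : ∀ xs → Fin (order (layers xs)) → ℕ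
lev (x ∷ xs) u = [ const 0 , suc ∘ lev xs ]′ (splitAt x u)

lev-↑ˡ : ∀ x xs i → lev (x ∷ xs) (i ↑ˡ order (layers xs)) ≡ 0
lev-↑ˡ x xs i rewrite splitAt-↑ˡ x i (order (layers xs)) = refl

lev-↑ʳ : ∀ x xs j → lev (x ∷ xs) (x ↑ʳ j) ≡ suc (lev xs j)
lev-↑ʳ x xs j rewrite splitAt-↑ʳ x (order (layers xs)) j = refl

-- Together with its converse below, this translates the test by which `sequentialSum` joins a
-- summand to the next one.
<headSize⇒lev≡0 : ∀ xs v → T (toℕ v <ᵇ headSize xs) → lev xs v ≡ 0
<headSize⇒lev≡0 (x ∷ xs) v v<x with splitAt x v in eq
... | inj₁ i = refl
... | inj₂ j = contradiction (<ᵇ⇒< (toℕ v) x v<x) (≤⇒≯ (subst (x ≤_) (trans (sym (toℕ-↑ʳ x j)) (cong toℕ (splitAt⁻¹-↑ʳ eq))) (m≤m+n x (toℕ j))))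

lev≡0⇒<headSizeSize : ∀ xs v → lev xs v ≡ 0 → T (toℕ v <ᵇ headSize xs)
lev≡0⇒<headSizeSize (x ∷ xs) v lev≡0 with splitAt x v in eq
... | inj₁ i = <⇒<ᵇ (subst (_< x) (trans (sym (toℕ-↑ˡ i _)) (cong toℕ (splitAt⁻¹-↑ˡ eq))) (toℕ<n i))

edge⇒lev-≤ : ∀ xs u w → T (edge (layers xs) u w) → lev xs w ≤ suc (lev xs u)
edge⇒lev-≤ (x ∷ xs) u w e with splitAt x u | splitAt x w
... | inj₁ _ | inj₁ _ = z≤n
... | inj₁ _ | inj₂ j = s≤s (≤-reflexive (<headSize⇒lev≡0 xs j e))
... | inj₂ _ | inj₁ _ = z≤n
... | inj₂ i | inj₂ j = s≤s (edge⇒lev-≤ xs i j e)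

-- Within a summand and between neighbouring ones every possible edge is present, so the levels
-- alone decide adjacency of distinct vertices.
lev-≤⇒edge : ∀ xs {u w} → u ≢ w → lev xs u ≤ suc (lev xs w) → lev xs w ≤ suc (lev xs u) → T (edge (layers xs) u w)
lev-≤⇒edge (x ∷ xs) {u} {w} u≢w u≤w w≤u with splitAt x u in equ | splitAt x w in eqw
... | inj₁ i | inj₁ j with i ≟ᶠ j
...   | no  _    = _
...   | yes refl = u≢w (trans (sym (splitAt⁻¹-↑ˡ equ)) (splitAt⁻¹-↑ˡ eqw))
lev-≤⇒edge (x ∷ xs) u≢w u≤w w≤u | inj₁ _ | inj₂ j = lev≡0⇒<headSizeSize xs j (n≤0⇒n≡0 (s≤s⁻¹ w≤u))
lev-≤⇒edge (x ∷ xs) u≢w u≤w w≤u | inj₂ i | inj₁ _ = lev≡0⇒<headSizeSize xs i (n≤0⇒n≡0 (s≤s⁻¹ u≤w))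
lev-≤⇒edge (x ∷ xs) u≢w u≤w w≤u | inj₂ i | inj₂ j =
  lev-≤⇒edge xs (λ { refl → u≢w (trans (sym (splitAt⁻¹-↑ʳ equ)) (splitAt⁻¹-↑ʳ eqw)) }) (s≤s⁻¹ u≤w) (s≤s⁻¹ w≤u)

headSize-≤ : ∀ xs → headSize xs ≤ order (layers xs)
headSize-≤ []       = z≤n
headSize-≤ (x ∷ xs) = m≤m+n x _

levelSize-zero : ∀ x xs → levelSize (lev (x ∷ xs)) 0 ≡ x
levelSize-zero x xs = begin
  levelSize (lev (x ∷ xs)) 0        ≡⟨ ∑-↑ x (λ u → 𝟙 (lev (x ∷ xs) u ≡ᵇ 0)) ⟩
  ∑ (λ i → 𝟙 (lev (x ∷ xs) (i ↑ˡ o) ≡ᵇ 0)) + ∑ (λ j → 𝟙 (lev (x ∷ xs) (x ↑ʳ j) ≡ᵇ 0))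
    ≡⟨ cong₂ _+_ (sum-cong-≗ λ i → cong (λ l → 𝟙 (l ≡ᵇ 0)) (lev-↑ˡ x xs i)) (sum-cong-≗ λ j → cong (λ l → 𝟙 (l ≡ᵇ 0)) (lev-↑ʳ x xs j)) ⟩
  ∑ {x} (λ _ → 1) + ∑ {o} (λ _ → 0) ≡⟨ cong₂ _+_ (∑-const x 1) (∑-const o 0) ⟩
  x * 1 + o * 0                     ≡⟨ final x o ⟩
  x                                 ∎
  where
  open ≡-Reasoning
  o = order (layers xs)
  final : ∀ x o → x * 1 + o * 0 ≡ x
  final = solve-∀

levelSize-suc : ∀ x xs k → levelSize (lev (x ∷ xs)) (suc k) ≡ levelSize (lev xs) k
levelSize-suc x xs k = begin
  levelSize (lev (x ∷ xs)) (suc k)        ≡⟨ ∑-↑ x (λ u → 𝟙 (lev (x ∷ xs) u ≡ᵇ suc k)) ⟩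
  ∑ (λ i → 𝟙 (lev (x ∷ xs) (i ↑ˡ o) ≡ᵇ suc k)) + ∑ (λ j → 𝟙 (lev (x ∷ xs) (x ↑ʳ j) ≡ᵇ suc k))
    ≡⟨ cong₂ _+_ (sum-cong-≗ λ i → cong (λ l → 𝟙 (l ≡ᵇ suc k)) (lev-↑ˡ x xs i)) (sum-cong-≗ λ j → cong (λ l → 𝟙 (l ≡ᵇ suc k)) (lev-↑ʳ x xs j)) ⟩
  ∑ {x} (λ _ → 0) + levelSize (lev xs) k
    ≡⟨ cong (_+ levelSize (lev xs) k) (trans (∑-const x 0) (*-zeroʳ x)) ⟩
  levelSize (lev xs) k                    ∎
  where
  open ≡-Reasoning
  o = order (layers xs)

∑-lev : ∀ x xs → ∑ (lev (x ∷ xs)) ≡ ∑ (lev xs) + order (layers xs)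
∑-lev x xs = begin
  ∑ (lev (x ∷ xs))        ≡⟨ ∑-↑ x (lev (x ∷ xs)) ⟩
  ∑ (λ i → lev (x ∷ xs) (i ↑ˡ o)) + ∑ (λ j → lev (x ∷ xs) (x ↑ʳ j))
    ≡⟨ cong₂ _+_ (sum-cong-≗ (lev-↑ˡ x xs)) (sum-cong-≗ λ j → trans (lev-↑ʳ x xs j) (+-comm 1 (lev xs j))) ⟩
  ∑ {x} (λ _ → 0) + ∑ (λ j → lev xs j + 1)
    ≡⟨ cong₂ _+_ (∑-const x 0) (∑-distrib-+ (lev xs) (λ _ → 1)) ⟩
  x * 0 + (∑ (lev xs) + ∑ {o} (λ _ → 1))          ≡⟨ cong (λ s → x * 0 + (∑ (lev xs) + s)) (∑-const o 1) ⟩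
  x * 0 + (∑ (lev xs) + o * 1)                    ≡⟨ final x (∑ (lev xs)) o ⟩
  ∑ (lev xs) + o          ∎
  where
  open ≡-Reasoning
  o = order (layers xs)
  final : ∀ x s o → x * 0 + (s + o * 1) ≡ s + o
  final = solve-∀

adjacencies : List ℕ → ℕ
adjacencies xs = ∑ λ u → ∑ λ w → 𝟙 (edge (layers xs) u w)

∑-<ᵇ : ∀ {n} h → h ≤ n → ∑ {n} (λ i → 𝟙 (toℕ i <ᵇ h)) ≡ h
∑-<ᵇ {n}     zero    _         = trans (∑-const n 0) (*-zeroʳ n)
∑-<ᵇ {suc n} (suc h) (s≤s h≤n) = cong suc (∑-<ᵇ h h≤n)

adjacencies-complete : ∀ x → ∑ (λ u → ∑ λ w → 𝟙 (edge (complete x) u w)) + x ≡ x * x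
adjacencies-complete x = begin
  ∑ (λ u → ∑ (e u)) + x
    ≡⟨ cong (∑ (λ u → ∑ (e u)) +_) (trans (∑-const x 1) (*-identityʳ x)) ⟨
  ∑ (λ u → ∑ (e u)) + ∑ {x} (λ _ → 1)     ≡⟨ ∑-distrib-+ (λ u → ∑ (e u)) (λ _ → 1) ⟨
  ∑ (λ u → ∑ (e u) + 1)                   ≡⟨ sum-cong-≗ row ⟩
  ∑ {x} (λ _ → x)                         ≡⟨ ∑-const x x ⟩
  x * x                                   ∎
  where
  open ≡-Reasoning
  e : Fin x → Fin x → ℕ
  e u w = 𝟙 (edge (complete x) u w)
  either : ∀ u w → e u w + δ u w ≡ 1
  either u w with u ≟ᶠ w
  ... | yes _ = refl
  ... | no  _ = refl
  row : ∀ u → ∑ (e u) + 1 ≡ x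
  row u = begin
    ∑ (e u) + 1                  ≡⟨ cong (∑ (e u) +_) (∑-δ u) ⟨
    ∑ (e u) + ∑ (δ u)            ≡⟨ ∑-distrib-+ (e u) (δ u) ⟨
    ∑ (λ w → e u w + δ u w)      ≡⟨ sum-cong-≗ (either u) ⟩
    ∑ {x} (λ _ → 1)              ≡⟨ trans (∑-const x 1) (*-identityʳ x) ⟩
    x                            ∎

-- Adding the order puts the diagonal back, so that the block of the first summand is a full square.
-- Each of the two mixed blocks contributes `x * headSize xs`.
adjacencies-∷ : ∀ x xs → adjacencies (x ∷ xs) + order (layers (x ∷ xs))
                         ≡ x * x + 2 * x * headSize xs + (adjacencies xs + order (layers xs))
adjacencies-∷ x xs = begin
  adjacencies (x ∷ xs) + (x + o)
    ≡⟨ cong (_+ (x + o)) blocks ⟩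
  (∑ (λ i → ∑ (c i)) + x * h) + (x * h + adjacencies xs) + (x + o)
    ≡⟨ regroup (∑ (λ i → ∑ (c i))) (x * h) (adjacencies xs) x o ⟩
  (∑ (λ i → ∑ (c i)) + x) + 2 * (x * h) + (adjacencies xs + o)
    ≡⟨ cong₂ (λ p q → p + q + (adjacencies xs + o)) (adjacencies-complete x) (sym (*-assoc 2 x h)) ⟩
  x * x + 2 * x * h + (adjacencies xs + o) ∎
  where
  open ≡-Reasoning
  o = order (layers xs)
  h = headSize xs
  G = layers (x ∷ xs)
  e : Fin (x + o) → Fin (x + o) → ℕ
  e u w = 𝟙 (edge G u w)
  c : Fin x → Fin x → ℕ
  c i j = 𝟙 (edge (complete x) i j)
  regroup : ∀ p q r x o → (p + q) + (q + r) + (x + o) ≡ (p + x) + 2 * q + (r + o)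
  regroup = solve-∀
  ll : ∀ i j → e (i ↑ˡ o) (j ↑ˡ o) ≡ c i j
  ll i j rewrite splitAt-↑ˡ x i o | splitAt-↑ˡ x j o = refl
  lr : ∀ i j → e (i ↑ˡ o) (x ↑ʳ j) ≡ 𝟙 (toℕ j <ᵇ h)
  lr i j rewrite splitAt-↑ˡ x i o | splitAt-↑ʳ x o j = refl
  rl : ∀ i j → e (x ↑ʳ i) (j ↑ˡ o) ≡ 𝟙 (toℕ i <ᵇ h)
  rl i j rewrite splitAt-↑ʳ x o i | splitAt-↑ˡ x j o = refl
  rr : ∀ i j → e (x ↑ʳ i) (x ↑ʳ j) ≡ 𝟙 (edge (layers xs) i j)
  rr i j rewrite splitAt-↑ʳ x o i | splitAt-↑ʳ x o j = refl
  left : ∀ i → ∑ (e (i ↑ˡ o)) ≡ ∑ (c i) + h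
  left i =
    trans (∑-↑ x (e (i ↑ˡ o))) (cong₂ _+_ (sum-cong-≗ (ll i)) (trans (sum-cong-≗ (lr i)) (∑-<ᵇ h (headSize-≤ xs))))
  right : ∀ i → ∑ (e (x ↑ʳ i)) ≡ x * 𝟙 (toℕ i <ᵇ h) + ∑ (λ j → 𝟙 (edge (layers xs) i j))
  right i =
    trans (∑-↑ x (e (x ↑ʳ i))) (cong₂ _+_ (trans (sum-cong-≗ (rl i)) (∑-const x _)) (sum-cong-≗ (rr i)))
  blocks : adjacencies (x ∷ xs) ≡ (∑ (λ i → ∑ (c i)) + x * h) + (x * h + adjacencies xs)
  blocks = trans (∑-↑ x (λ u → ∑ (e u))) (cong₂ _+_
    (trans (sum-cong-≗ left) (trans (∑-distrib-+ (λ i → ∑ (c i)) (λ _ → h)) (cong (∑ (λ i → ∑ (c i)) +_) (∑-const x h))))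
    (trans (sum-cong-≗ right) (trans (∑-distrib-+ (λ i → x * 𝟙 (toℕ i <ᵇ h)) (λ i → ∑ λ j → 𝟙 (edge (layers xs) i j)))
      (cong (_+ adjacencies xs) (trans (sym (*-distribˡ-sum x (λ (i : Fin o) → 𝟙 (toℕ i <ᵇ h)))) (cong (x *_) (∑-<ᵇ h (headSize-≤ xs))))))))

-- Connectivity and distances of layered graphs

open Graph using (order; edge)

Unique⇒lookup-injective : ∀ {A : Set} {xs : List A} → Unique xs → ∀ i j → lookup xs i ≡ lookup xs j → i ≡ j
Unique⇒lookup-injective (_ ∷ _)     zero    zero    _  = refl
Unique⇒lookup-injective (x∉xs ∷ _)  zero    (suc j) eq = contradiction eq (All.lookup x∉xs (∈-lookup j))
Unique⇒lookup-injective (x∉xs ∷ _)  (suc i) zero    eq =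
  contradiction (sym eq) (All.lookup x∉xs (∈-lookup i))
Unique⇒lookup-injective (_ ∷ un)    (suc i) (suc j) eq = cong suc (Unique⇒lookup-injective un i j eq)

-- Pigeonhole: otherwise `S` would contain all elements that satisfy `p`.
outside : ∀ {n} (S : Subset n) (p : Fin n → Bool) → ∣ S ∣ < ∑ (𝟙 ∘ p) → ∃[ x ] T (p x) × x ∉ˢ S
outside S p ∣S∣<p with any? (λ x → T? (p x) ×-dec ¬? (x ∈? S))
... | yes found = found
... | no  none  = contradiction (subst (∑ (𝟙 ∘ p) ≤_) (sym (∣∣-∑ S)) (∑-mono inside)) (<⇒≱ ∣S∣<p)
  where
  inside : ∀ x → 𝟙 (p x) ≤ 𝟙 (Vec.lookup S x)
  inside x with x ∈? S
  ... | yes x∈S rewrite []=⇒lookup x∈S = 𝟙≤1 (p x)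
    where
    𝟙≤1 : ∀ b → 𝟙 b ≤ 1
    𝟙≤1 true  = ≤-refl
    𝟙≤1 false = z≤n
  ... | no  x∉S with p x in eq
  ...   | true  = contradiction (x , subst T (sym eq) _ , x∉S) none
  ...   | false = z≤n

module Bidirected (xs : List ℕ) (κ : ℕ) (1≤κ : 1 ≤ κ)
  (thick : ∀ u w k → lev xs u < k → k < lev xs w → κ ≤ levelSize (lev xs) k) where

  D : Digraph
  D = bidirected (layers xs)

  strong : Strong D
  strong = dense⇒strong D (lev xs) (lev-≤⇒edge xs) λ {u} {w} k u<k k<w →
    -- With the empty set, `outside` only says that level `k` is inhabited.
    let x , lev≡ , _ = outside ⊥ (λ u → lev xs u ≡ᵇ k)
                         (subst (_< levelSize (lev xs) k) (sym (∣⊥∣≡0 (order (layers xs)))) (≤-trans 1≤κ (thick u w k u<k k<w)))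
    in x , ≡ᵇ⇒≡ _ _ lev≡

  -- Fewer than κ removed vertices cannot exhaust an inner level, so the rest still meets every
  -- level in between and `dense⇒strong` applies to it.
  connected : Connected κ D
  connected S ¬strong =
    ≮⇒≥ λ ∣S∣<κ → ¬strong (dense⇒strong (removeVertices D S) (λ i → lev xs (lookup (kept D S) i))
    (λ {i} {j} i≢j → lev-≤⇒edge xs (i≢j ∘ Unique⇒lookup-injective unique i j))
    λ {i} {j} k u<k k<w →
      let x , lev≡ , x∉S = outside S (λ u → lev xs u ≡ᵇ k)
                             (≤-trans ∣S∣<κ (thick (lookup (kept D S) i) (lookup (kept D S) j) k u<k k<w))
          i , lookup≡    = kept-index D S x∉S
      in i , trans (cong (lev xs) lookup≡) (≡ᵇ⇒≡ _ _ lev≡))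
    where
    unique : Unique (kept D S)
    unique = filter⁺ (λ v → ¬? (v ∈? S)) (allFin⁺ _)

  eulerian : Fin (order (layers xs)) → Eulerian D
  eulerian = SymmetricEulerian.eulerian D (Graph.symmetric (layers xs)) strong

  -- Along an arc the level grows by at most one.
  lev-≤-dist : ∀ {v} → lev xs v ≡ 0 → ∀ w → lev xs w ≤ dist D v w
  lev-≤-dist {v} lev≡0 w with dist-correct D (strong v w)
  ... | ((p , _) , len) , _ = subst₂ _≤_ refl (trans (cong (walkLength p +_) lev≡0) (trans (+-identityʳ _) len)) (along p)
    where
    along : ∀ {u w} (p : Walk D u w) → lev xs w ≤ walkLength p + lev xs u
    along []                      = ≤-refl
    along (_∷_ {u =
      u} {v = x} a p) = ≤-trans (along p) (≤-trans (+-monoʳ-≤ (walkLength p) (edge⇒lev-≤ xs u x a)) (≤-reflexive (+-suc _ _)))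

-- Distances and sizes of path-complete graphs

module _ (κ : ℕ) where

  layersAfter1 : (ℓ a b : ℕ) → List ℕ
  layersAfter1 ℓ a b = replicate ℓ κ ++ a ∷ b ∷ []

  pathComplete : (ℓ a b : ℕ) → Graph
  pathComplete ℓ a b = layers (1 ∷ layersAfter1 ℓ a b)

  pathComplete-def : ∀ ℓ a b → sequentialSum (complete 1 ∷ replicate ℓ (complete κ) ++ complete a ∷ complete b ∷ [])
    ≡ pathComplete ℓ a b
  pathComplete-def ℓ a b = cong (λ Gs → sequentialSum (complete 1 ∷ Gs))
    (trans (cong (_++ complete a ∷ complete b ∷ []) (sym (map-replicate complete ℓ κ)))
           (sym (map-++ complete (replicate ℓ κ) (a ∷ b ∷ []))))

  order-layersAfter1 : ∀ ℓ a b → order (layers (layersAfter1 ℓ a b)) ≡ κ * ℓ + (a + b)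
  order-layersAfter1 zero    a b = trans (cong (a +_) (+-identityʳ b)) (cong (_+ (a + b)) (sym (*-zeroʳ κ)))
  order-layersAfter1 (suc ℓ) a b =
    trans (cong (κ +_) (order-layersAfter1 ℓ a b)) (trans (sym (+-assoc κ (κ * ℓ) (a + b))) (cong (_+ (a + b)) (sym (*-suc κ ℓ))))

  -- The total distance from the end vertex `K_1`, and the largest total distance of any vertex, as
  -- `PathCompleteDistances` shows.
  endDistance : (ℓ a b : ℕ) → ℕ
  endDistance ℓ a b = ∑ (lev (1 ∷ layersAfter1 ℓ a b))

  2*endDistance : ∀ ℓ a b → 2 * endDistance ℓ a b ≡ κ * (ℓ * suc ℓ) + 2 * (suc ℓ * a + suc (suc ℓ) * b)
  2*endDistance zero a b rewrite ∑-lev 1 (a ∷ b ∷ []) | ∑-lev a (b ∷ []) | ∑-lev b [] = identity κ a b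
    where
    identity : ∀ k a b → 2 * (0 + 0 + (b + 0) + (a + (b + 0))) ≡ k * (0 * 1) + 2 * (1 * a + 2 * b)
    identity = solve-∀
  2*endDistance (suc ℓ) a b = begin
    2 * endDistance (suc ℓ) a b
      ≡⟨ cong (2 *_) (trans (∑-lev 1 (κ ∷ layersAfter1 ℓ a b)) (cong (_+ (κ + o)) (trans (∑-lev κ (layersAfter1 ℓ a b)) (sym (∑-lev 1 (layersAfter1 ℓ a b)))))) ⟩
    2 * (endDistance ℓ a b + (κ + o))                 ≡⟨ *-distribˡ-+ 2 (endDistance ℓ a b) (κ + o) ⟩
    2 * endDistance ℓ a b + 2 * (κ + o)
      ≡⟨ cong₂ (λ p q → p + 2 * (κ + q)) (2*endDistance ℓ a b) (order-layersAfter1 ℓ a b) ⟩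
    κ * (ℓ * suc ℓ) + 2 * (suc ℓ * a + suc (suc ℓ) * b) + 2 * (κ + (κ * ℓ + (a + b)))
      ≡⟨ identity κ ℓ a b ⟩
    κ * (suc ℓ * suc (suc ℓ)) + 2 * (suc (suc ℓ) * a + suc (suc (suc ℓ)) * b) ∎
    where
    open ≡-Reasoning
    o = order (layers (layersAfter1 ℓ a b))
    identity : ∀ k ℓ a b → k * (ℓ * suc ℓ) + 2 * (suc ℓ * a + suc (suc ℓ) * b) + 2 * (k + (k * ℓ + (a + b)))
                           ≡ k * (suc ℓ * suc (suc ℓ)) + 2 * (suc (suc ℓ) * a + suc (suc (suc ℓ)) * b)
    identity = solve-∀

  -- The relation between distances and size is proved without the first vertex, so that every
  -- inductive step prepends `K_κ`. It starts at `suc ℓ` because the step needs the next summand to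
  -- have exactly κ vertices.
  layersAfter1-size : ∀ ℓ a b → let xs = layersAfter1 (suc ℓ) a b; o = order (layers xs) in
    2 * κ * ∑ (lev xs) + (adjacencies xs + o) + 2 * κ * κ ≡ o * o + 2 * κ * o
  layersAfter1-size zero a b
    rewrite adjacencies-∷ κ (a ∷ b ∷ []) | adjacencies-∷ a (b ∷ []) | adjacencies-∷ b []
          | ∑-lev κ (a ∷ b ∷ []) | ∑-lev a (b ∷ []) | ∑-lev b [] = identity κ a b
    where
    identity : ∀ k a b → 2 * k * (0 + 0 + (b + 0) + (a + (b + 0)))
                           + (k * k + 2 * k * a + (a * a + 2 * a * b + (b * b + 2 * b * 0 + 0))) + 2 * k * k
                         ≡ (k + (a + (b + 0))) * (k + (a + (b + 0))) + 2 * k * (k + (a + (b + 0)))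
    identity = solve-∀
  layersAfter1-size (suc ℓ) a b = begin
    2 * κ * ∑ (lev (κ ∷ xs)) + (adjacencies (κ ∷ xs) + (κ + o)) + 2 * κ * κ
      ≡⟨ cong₂ (λ p q → 2 * κ * p + q + 2 * κ * κ) (∑-lev κ xs) (adjacencies-∷ κ xs) ⟩
    2 * κ * (∑ (lev xs) + o) + (κ * κ + 2 * κ * κ + (adjacencies xs + o)) + 2 * κ * κ
      ≡⟨ regroup κ (∑ (lev xs)) (adjacencies xs + o) o ⟩
    (2 * κ * ∑ (lev xs) + (adjacencies xs + o) + 2 * κ * κ) + (2 * κ * o + 3 * (κ * κ))
      ≡⟨ cong (_+ (2 * κ * o + 3 * (κ * κ))) (layersAfter1-size ℓ a b) ⟩
    (o * o + 2 * κ * o) + (2 * κ * o + 3 * (κ * κ))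
      ≡⟨ final κ o ⟩
    (κ + o) * (κ + o) + 2 * κ * (κ + o) ∎
    where
    open ≡-Reasoning
    xs = layersAfter1 (suc ℓ) a b
    o = order (layers xs)
    regroup : ∀ k s e o → 2 * k * (s + o) + (k * k + 2 * k * k + e) + 2 * k * k
      ≡ (2 * k * s + e + 2 * k * k) + (2 * k * o + 3 * (k * k))
    regroup = solve-∀
    final : ∀ k o → (o * o + 2 * k * o) + (2 * k * o + 3 * (k * k)) ≡ (k + o) * (k + o) + 2 * k * (k + o)
    final = solve-∀

  -- Equality in `totalDistance-size`: the first vertex is put back, and its degree is κ as `1 ≤ ℓ`.
  pathComplete-size : ∀ {ℓ} a b → 1 ≤ ℓ → (N : ℕ) → κ * ℓ + (a + b) ≡ N →
    2 * κ * endDistance ℓ a b + 2 * graphSize (pathComplete ℓ a b) + suc N + 2 * κ * κ ≡ N * N + 4 * κ * N + 1 + 2 * κ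
  pathComplete-size {suc ℓ} a b _ N eq with trans (order-layersAfter1 (suc ℓ) a b) eq
  ... | refl = begin
    2 * κ * ∑ (lev (1 ∷ xs)) + 2 * graphSize (layers (1 ∷ xs)) + suc o + 2 * κ * κ
      ≡⟨ cong (_+ 2 * κ * κ) (+-assoc (2 * κ * ∑ (lev (1 ∷ xs))) (2 * graphSize (layers (1 ∷ xs))) (suc o)) ⟩
    2 * κ * ∑ (lev (1 ∷ xs)) + (2 * graphSize (layers (1 ∷ xs)) + suc o) + 2 * κ * κ
      ≡⟨ cong₂ (λ p q → 2 * κ * p + q + 2 * κ * κ) (∑-lev 1 xs)
           (trans (cong (_+ suc o) (trans (2*graphSize (layers (1 ∷ xs))) (size-∑ (bidirected (layers (1 ∷ xs)))))) (adjacencies-∷ 1 xs)) ⟩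
    2 * κ * (∑ (lev xs) + o) + (1 + 2 * 1 * κ + (adjacencies xs + o)) + 2 * κ * κ
      ≡⟨ regroup κ (∑ (lev xs)) (adjacencies xs + o) o ⟩
    (2 * κ * ∑ (lev xs) + (adjacencies xs + o) + 2 * κ * κ) + (2 * κ * o + 1 + 2 * κ)
      ≡⟨ cong (_+ (2 * κ * o + 1 + 2 * κ)) (layersAfter1-size ℓ a b) ⟩
    (o * o + 2 * κ * o) + (2 * κ * o + 1 + 2 * κ)
      ≡⟨ final κ o ⟩
    o * o + 4 * κ * o + 1 + 2 * κ ∎
    where
    open ≡-Reasoning
    xs = layersAfter1 (suc ℓ) a b
    o = order (layers xs)
    regroup : ∀ k s e o → 2 * k * (s + o) + (1 + 2 * 1 * k + e) + 2 * k * k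
      ≡ (2 * k * s + e + 2 * k * k) + (2 * k * o + 1 + 2 * k)
    regroup = solve-∀
    final : ∀ k o → (o * o + 2 * k * o) + (2 * k * o + 1 + 2 * k) ≡ o * o + 4 * k * o + 1 + 2 * k
    final = solve-∀

  -- Only the last level, of size `b`, may be thin, and no vertex lies above it.
  layersAfter1-thick : ∀ ℓ {a} b → κ ≤ a → ∀ k w → k < lev (layersAfter1 ℓ a b) w → κ ≤ levelSize (lev (layersAfter1 ℓ a b)) k
  layersAfter1-thick zero    {a} b κ≤a zero    w k<w = subst (κ ≤_) (sym (levelSize-zero a (b ∷ []))) κ≤a
  layersAfter1-thick zero    {a} b κ≤a (suc k) w k<w with splitAt a w
  ... | inj₂ j with splitAt b j
  ...   | inj₁ _ = contradiction k<w λ { (s≤s ()) }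
  layersAfter1-thick (suc ℓ) {a} b κ≤a zero    w k<w =
    ≤-reflexive (sym (levelSize-zero κ (layersAfter1 ℓ a b)))
  layersAfter1-thick (suc ℓ) {a} b κ≤a (suc k) w k<w with splitAt κ w
  ... | inj₂ j = subst (κ ≤_) (sym (levelSize-suc κ (layersAfter1 ℓ a b) k)) (layersAfter1-thick ℓ b κ≤a k j (s≤s⁻¹ k<w))

  thick : ∀ ℓ {a} b → κ ≤ a → ∀ u w k → lev (1 ∷ layersAfter1 ℓ a b) u < k → k < lev (1 ∷ layersAfter1 ℓ a b) w →
          κ ≤ levelSize (lev (1 ∷ layersAfter1 ℓ a b)) k
  thick ℓ {a} b κ≤a _ w (suc k) _ k<w with splitAt 1 w
  ... | inj₂ j = subst (κ ≤_) (sym (levelSize-suc 1 (layersAfter1 ℓ a b) k)) (layersAfter1-thick ℓ b κ≤a k j (s≤s⁻¹ k<w))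

module PathCompleteDistances {κ ℓ a} (1≤κ : 1 ≤ κ) (1≤ℓ : 1 ≤ ℓ) (κ≤a : κ ≤ a) (b : ℕ) where
  open Bidirected (1 ∷ layersAfter1 κ ℓ a b) κ 1≤κ (thick κ ℓ b κ≤a) using (D; connected; eulerian; lev-≤-dist) public

  N : ℕ
  N = κ * ℓ + (a + b)

  order≡ : Digraph.order D ≡ suc N
  order≡ = cong suc (order-layersAfter1 κ ℓ a b)

  -- The general bound applies to the path-complete graph itself, and by `pathComplete-size` the
  -- value `endDistance` attains it at the same size.
  totalDistance-≤ : ∀ v → totalDistance D v ≤ endDistance κ ℓ a b
  totalDistance-≤ v = *-cancelˡ-≤ (2 * κ) ⦃ m*n≢0 2 κ ⦃ _ ⦄ ⦃ >-nonZero 1≤κ ⦄ ⦄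
    (+-cancelʳ-≤ (Digraph.size D) _ _ (+-cancelʳ-≤ (suc N) _ _ (+-cancelʳ-≤ (2 * κ * κ) _ _ (begin
      2 * κ * totalDistance D v + Digraph.size D + suc N + 2 * κ * κ
        ≤⟨ Bounds.totalDistance-size 1≤κ D connected (eulerian v) v order≡ κ≤N ⟩
      N * N + 4 * κ * N + 1 + 2 * κ
        ≡⟨ pathComplete-size κ a b 1≤ℓ N refl ⟨
      2 * κ * endDistance κ ℓ a b + 2 * graphSize (pathComplete κ ℓ a b) + suc N + 2 * κ * κ
        ≡⟨ cong (λ z → 2 * κ * endDistance κ ℓ a b + z + suc N + 2 * κ * κ) (2*graphSize (pathComplete κ ℓ a b)) ⟩
      2 * κ * endDistance κ ℓ a b + Digraph.size D + suc N + 2 * κ * κ ∎))))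
    where
    open ≤-Reasoning
    κ≤N : κ ≤ N
    κ≤N = ≤-trans κ≤a (≤-trans (m≤m+n a b) (m≤n+m (a + b) (κ * ℓ)))

  endDistance-≤ : endDistance κ ℓ a b ≤ totalDistance D zero
  endDistance-≤ = ∑-mono (lev-≤-dist {zero} refl)

-- Rational arithmetic

toℚᵘ-⁄ : ∀ p q → toℚᵘ (p ⁄ suc q) ℚᵘ.≃ mkℚᵘ (pos p) q
toℚᵘ-⁄ p q = ℚ.toℚᵘ-fromℚᵘ (mkℚᵘ (pos p) q)

⁄-cross : ∀ p q r s → p * suc s ≡ r * suc q → p ⁄ suc q ≡ r ⁄ suc s
⁄-cross p q r s eq =
  ℚ.fromℚᵘ-cong {mkℚᵘ (pos p) q} {mkℚᵘ (pos r) s} (*≡* (trans (sym (ℤ.pos-* p (suc s))) (trans (cong pos eq) (ℤ.pos-* r (suc q)))))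

⁄-mono-≤ : ∀ {p r} q → p ≤ r → p ⁄ suc q ℚ.≤ r ⁄ suc q
⁄-mono-≤ {p} {r} q p≤r = ℚ.toℚᵘ-cancel-≤ (begin
  toℚᵘ (p ⁄ suc q)     ≃⟨ toℚᵘ-⁄ p q ⟩
  mkℚᵘ (pos p) q         ≤⟨ *≤* (ℤ.*-monoʳ-≤-nonNeg (pos (suc q)) (ℤ.+≤+ p≤r)) ⟩
  mkℚᵘ (pos r) q         ≃⟨ toℚᵘ-⁄ r q ⟨
  toℚᵘ (r ⁄ suc q)     ∎)
  where open ℚᵘ.≤-Reasoning

⁄-+ : ∀ p r q → p ⁄ suc q ℚ.+ r ⁄ suc q ≡ (p + r) ⁄ suc q
⁄-+ p r q = ℚ.toℚᵘ-injective (begin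
  toℚᵘ (p ⁄ suc q ℚ.+ r ⁄ suc q)               ≈⟨ ℚ.toℚᵘ-homo-+ (p ⁄ suc q) (r ⁄ suc q) ⟩
  toℚᵘ (p ⁄ suc q) ℚᵘ.+ toℚᵘ (r ⁄ suc q)       ≈⟨ ℚᵘ.+-cong (toℚᵘ-⁄ p q) (toℚᵘ-⁄ r q) ⟩
  mkℚᵘ (pos p) q ℚᵘ.+ mkℚᵘ (pos r) q               ≈⟨ *≡* (identity (pos p) (pos r) (pos (suc q))) ⟩
  mkℚᵘ (pos (p + r)) q                           ≈⟨ toℚᵘ-⁄ (p + r) q ⟨
  toℚᵘ ((p + r) ⁄ suc q)                       ∎)
  where
  open import Relation.Binary.Reasoning.Setoid ℚᵘ.≃-setoid
  identity : ∀ p r q → (p ℤ.* q ℤ.+ r ℤ.* q) ℤ.* q ≡ (p ℤ.+ r) ℤ.* (q ℤ.* q)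
  identity = ℤ-Solver.solve-∀

1⁄-* : ∀ p q → 1 ⁄ suc q ℚ.* (p ⁄ 1) ≡ p ⁄ suc q
1⁄-* p q = ℚ.toℚᵘ-injective (begin
  toℚᵘ (1 ⁄ suc q ℚ.* (p ⁄ 1))                 ≈⟨ ℚ.toℚᵘ-homo-* (1 ⁄ suc q) (p ⁄ 1) ⟩
  toℚᵘ (1 ⁄ suc q) ℚᵘ.* toℚᵘ (p ⁄ 1)           ≈⟨ ℚᵘ.*-cong (toℚᵘ-⁄ 1 q) (toℚᵘ-⁄ p 0) ⟩
  mkℚᵘ 1ℤ q ℚᵘ.* mkℚᵘ (pos p) 0                  ≈⟨ *≡* (identity (pos p) (pos (suc q))) ⟩
  mkℚᵘ (pos p) q                                 ≈⟨ toℚᵘ-⁄ p q ⟨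
  toℚᵘ (p ⁄ suc q)                             ∎)
  where
  open import Relation.Binary.Reasoning.Setoid ℚᵘ.≃-setoid
  identity : ∀ p q → (1ℤ ℤ.* p) ℤ.* q ≡ p ℤ.* (q ℤ.* 1ℤ)
  identity = ℤ-Solver.solve-∀

module _ (D : Digraph) {N} (1≤N : 1 ≤ N) (order≡ : Digraph.order D ≡ suc N) where

  averageDistance-⁄ : ∀ v → averageDistance D v ≡ totalDistance D v ⁄ N
  averageDistance-⁄ v = begin
    averageDistance D v
      ≡⟨ cong₂ (λ p s → 1 ⁄ p ℚ.* (s ⁄ 1)) (cong (_∸ 1) order≡) (sum-allFin (dist D v)) ⟩
    1 ⁄ N ℚ.* (totalDistance D v ⁄ 1)                 ≡⟨ product 1≤N ⟩
    totalDistance D v ⁄ N                             ∎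
    where
    open ≡-Reasoning
    product : ∀ {N} → 1 ≤ N → 1 ⁄ N ℚ.* (totalDistance D v ⁄ 1) ≡ totalDistance D v ⁄ N
    product {suc M} _ = 1⁄-* (totalDistance D v) M

  ⁄N-mono-≤ : ∀ {p r} → p ≤ r → p ⁄ N ℚ.≤ r ⁄ N
  ⁄N-mono-≤ = go 1≤N
    where
    go : ∀ {N p r} → 1 ≤ N → p ≤ r → p ⁄ N ℚ.≤ r ⁄ N
    go {suc M} _ = ⁄-mono-≤ M

  remoteness-≤ : ∀ {t} → (∀ v → totalDistance D v ≤ t) → remoteness D ℚ.≤ t ⁄ N
  remoteness-≤ {t} total≤t = go (allFin (Digraph.order D))
    where
    0⁄ : ∀ {N} → 1 ≤ N → 0 ⁄ N ≡ 0ℚ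
    0⁄ {suc M} _ = ⁄-cross 0 M 0 0 refl
    go : ∀ vs → foldr ℚ._⊔_ 0ℚ (map (averageDistance D) vs) ℚ.≤ t ⁄ N
    go []       = subst (ℚ._≤ t ⁄ N) (0⁄ 1≤N) (⁄N-mono-≤ z≤n)
    go (v ∷ vs) = ℚ.⊔-lub (subst (ℚ._≤ t ⁄ N) (sym (averageDistance-⁄ v)) (⁄N-mono-≤ (total≤t v))) (go vs)

  remoteness-≥ : ∀ v → totalDistance D v ⁄ N ℚ.≤ remoteness D
  remoteness-≥ v = subst (ℚ._≤ remoteness D) (averageDistance-⁄ v) (go (∈-allFin v))
    where
    go : ∀ {vs} → v ∈ vs → averageDistance D v ℚ.≤ foldr ℚ._⊔_ 0ℚ (map (averageDistance D) vs)
    go {u ∷ vs} (here refl)  = ℚ.p≤p⊔q (averageDistance D u) _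
    go {u ∷ vs} (there v∈vs) = ℚ.p≤q⇒p≤r⊔q (averageDistance D u) (go v∈vs)

-- The subtracted fractions are moved to the other side, so that all numerators are natural, and
-- everything is compared over the denominator `2 * κ * N`.
remotenessBound-⁄ : ∀ {κ N m σ} → 1 ≤ κ → 1 ≤ N →
  2 * κ * σ + 2 * m + suc N + 2 * κ * κ ≡ N * N + 4 * κ * N + 1 + 2 * κ → σ ⁄ N ≡ remotenessBound (suc N) m κ
remotenessBound-⁄ {suc k} {suc M} {m} {σ} _ _ eq = begin
  s                                              ≡⟨ cancel s i r μ ⟨
  (s ℚ.+ μ ℚ.+ r ℚ.+ i) ℚ.- i ℚ.- r ℚ.- μ        ≡⟨ cong (λ x → x ℚ.- i ℚ.- r ℚ.- μ) sums ⟩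
  (a ℚ.+ 2 ⁄ 1) ℚ.- i ℚ.- r ℚ.- μ                ∎
  where
  open ≡-Reasoning
  κ = suc k
  N = suc M
  -- Chosen so that `suc c′` is `2 * κ * N` by computation; `_⁄_` reduces only at a successor.
  c′ = M + (k + 1 * κ) * N
  c = suc c′
  s = σ ⁄ N
  a = suc N ⁄ (2 * κ)
  i = 1 ⁄ κ
  r = k ⁄ N
  μ = m ⁄ (κ * N)
  cancel : ∀ s i r μ → (s ℚ.+ μ ℚ.+ r ℚ.+ i) ℚ.- i ℚ.- r ℚ.- μ ≡ s
  cancel s i r μ =
    trans (cong (λ x → x ℚ.- r ℚ.- μ) (drop (s ℚ.+ μ ℚ.+ r) i)) (trans (cong (ℚ._- μ) (drop (s ℚ.+ μ) r)) (drop s μ))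
    where
    drop : ∀ x y → (x ℚ.+ y) ℚ.- y ≡ x
    drop x y = trans (ℚ.+-assoc x y (ℚ.- y)) (trans (cong (x ℚ.+_) (ℚ.+-inverseʳ y)) (ℚ.+-identityʳ x))
  s≡ : s ≡ (2 * κ * σ) ⁄ c
  s≡ = ⁄-cross σ M (2 * κ * σ) c′ (identity κ N σ)
    where
    identity : ∀ k N σ → σ * (2 * k * N) ≡ 2 * k * σ * N
    identity = solve-∀
  μ≡ : μ ≡ (2 * m) ⁄ c
  μ≡ = ⁄-cross m (M + k * N) (2 * m) c′ (identity κ N m)
    where
    identity : ∀ k N m → m * (2 * k * N) ≡ 2 * m * (k * N)
    identity = solve-∀
  r≡ : r ≡ (2 * κ * k) ⁄ c
  r≡ = ⁄-cross k M (2 * κ * k) c′ (identity κ N k)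
    where
    identity : ∀ κ N k → k * (2 * κ * N) ≡ 2 * κ * k * N
    identity = solve-∀
  i≡ : i ≡ (2 * N) ⁄ c
  i≡ = ⁄-cross 1 k (2 * N) c′ (identity κ N)
    where
    identity : ∀ κ N → 1 * (2 * κ * N) ≡ 2 * N * κ
    identity = solve-∀
  a≡ : a ≡ (suc N * N) ⁄ c
  a≡ = ⁄-cross (suc N) (k + 1 * κ) (suc N * N) c′ (identity κ N)
    where
    identity : ∀ κ N → suc N * (2 * κ * N) ≡ suc N * N * (2 * κ)
    identity = solve-∀
  2≡ : 2 ⁄ 1 ≡ (2 * c) ⁄ c
  2≡ = ⁄-cross 2 0 (2 * c) c′ (identity c)
    where
    identity : ∀ c → 2 * c ≡ 2 * c * 1
    identity = solve-∀
  numerators : 2 * κ * σ + 2 * m + 2 * κ * k + 2 * N ≡ suc N * N + 2 * c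
  -- With `1 + 2 * κ` added on both sides, this is `eq` with `N` added.
  numerators = +-cancelʳ-≡ (1 + 2 * κ) _ _ (trans (left k N σ m) (trans (cong (_+ N) eq) (right k N)))
    where
    left : ∀ k N σ m → 2 * suc k * σ + 2 * m + 2 * suc k * k + 2 * N + (1 + 2 * suc k)
      ≡ 2 * suc k * σ + 2 * m + suc N + 2 * suc k * suc k + N
    left = solve-∀
    right : ∀ k N → N * N + 4 * suc k * N + 1 + 2 * suc k + N
      ≡ suc N * N + 2 * (2 * suc k * N) + (1 + 2 * suc k)
    right = solve-∀
  sums : s ℚ.+ μ ℚ.+ r ℚ.+ i ≡ a ℚ.+ 2 ⁄ 1
  sums = begin
    s ℚ.+ μ ℚ.+ r ℚ.+ i
      ≡⟨ cong₂ ℚ._+_ (cong₂ ℚ._+_ (cong₂ ℚ._+_ s≡ μ≡) r≡) i≡ ⟩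
    (2 * κ * σ) ⁄ c ℚ.+ (2 * m) ⁄ c ℚ.+ (2 * κ * k) ⁄ c ℚ.+ (2 * N) ⁄ c
      ≡⟨ cong (λ x → x ℚ.+ (2 * κ * k) ⁄ c ℚ.+ (2 * N) ⁄ c) (⁄-+ (2 * κ * σ) (2 * m) c′) ⟩
    (2 * κ * σ + 2 * m) ⁄ c ℚ.+ (2 * κ * k) ⁄ c ℚ.+ (2 * N) ⁄ c
      ≡⟨ cong (ℚ._+ (2 * N) ⁄ c) (⁄-+ (2 * κ * σ + 2 * m) (2 * κ * k) c′) ⟩
    (2 * κ * σ + 2 * m + 2 * κ * k) ⁄ c ℚ.+ (2 * N) ⁄ c
      ≡⟨ ⁄-+ (2 * κ * σ + 2 * m + 2 * κ * k) (2 * N) c′ ⟩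
    (2 * κ * σ + 2 * m + 2 * κ * k + 2 * N) ⁄ c
      ≡⟨ cong (_⁄ c) numerators ⟩
    (suc N * N + 2 * c) ⁄ c
      ≡⟨ ⁄-+ (suc N * N) (2 * c) c′ ⟨
    (suc N * N) ⁄ c ℚ.+ (2 * c) ⁄ c
      ≡⟨ cong₂ ℚ._+_ a≡ 2≡ ⟨
    a ℚ.+ 2 ⁄ 1 ∎

remotenessBound-antimono : ∀ {κ N m m′} → 1 ≤ κ → 1 ≤ N → m ≤ m′ →
  remotenessBound (suc N) m′ κ ℚ.≤ remotenessBound (suc N) m κ
remotenessBound-antimono {suc k} {suc M} _ _ m≤m′ =
  ℚ.+-monoʳ-≤ (suc (suc M) ⁄ (2 * suc k) ℚ.+ 2 ⁄ 1 ℚ.- 1 ⁄ suc k ℚ.- k ⁄ suc M) (ℚ.neg-antimono-≤ (⁄-mono-≤ (M + k * suc M) m≤m′))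

½-≤ : ∀ z m → ½ ℚ.* (z ℚ./ 1) ℚ.≤ m ⁄ 1 → z ℤ.≤ pos (2 * m)
½-≤ z m half≤ = subst₂ ℤ._≤_ (left z) (trans (ℤ.*-comm (pos m) (pos 2)) (sym (ℤ.pos-* 2 m))) (ℚᵘ.drop-*≤* (begin
  mkℚᵘ 1ℤ 1 ℚᵘ.* mkℚᵘ z 0             ≃⟨ ℚᵘ.*-congˡ (ℚ.toℚᵘ-fromℚᵘ (mkℚᵘ z 0)) ⟨
  toℚᵘ ½ ℚᵘ.* toℚᵘ (z ℚ./ 1)          ≃⟨ ℚ.toℚᵘ-homo-* ½ (z ℚ./ 1) ⟨
  toℚᵘ (½ ℚ.* (z ℚ./ 1))              ≤⟨ ℚ.toℚᵘ-mono-≤ half≤ ⟩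
  toℚᵘ (m ⁄ 1)                        ≃⟨ toℚᵘ-⁄ m 0 ⟩
  mkℚᵘ (pos m) 0                        ∎))
  where
  open ℚᵘ.≤-Reasoning
  left : ∀ z → (1ℤ ℤ.* z) ℤ.* 1ℤ ≡ z
  left = ℤ-Solver.solve-∀

-- The minimum path-complete graph

modulo⇒offset : ∀ {x y κ} → x ≡ y modulo κ → ∃[ q ] (x + κ * q ≡ y ⊎ y + κ * q ≡ x)
modulo⇒offset {x} {y} {κ} (divides q eq) with ≤-total x y
... | inj₁ x≤y = q , inj₁ (trans (cong (x +_) (trans (*-comm κ q) (trans (sym eq) (m≤n⇒∣m-n∣≡n∸m x≤y)))) (m+[n∸m]≡n x≤y))
... | inj₂ y≤x = q , inj₂ (trans (cong (y +_) (trans (*-comm κ q) (trans (sym eq) (m≤n⇒∣n-m∣≡n∸m y≤x)))) (m+[n∸m]≡n y≤x))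

-- The multiples `κ * A` and `κ * B` leave room on both sides, so that whichever of `m` and `y` is
-- larger no subtraction occurs.
modulo⇒∣ : ∀ {m y κ} → m ≡ y modulo κ → ∀ A B d → κ * A + (m + d) ≡ y + κ * B → κ ∣ d
modulo⇒∣ {m} {y} {κ} m≡y A B d eq with modulo⇒offset {m} {y} {κ} m≡y
... | q , inj₁ refl = ∣m+n∣m⇒∣n (subst (κ ∣_) (sym multiple) (m∣m*n (q + B))) (m∣m*n A)
  where
  left : ∀ k A m d → m + (k * A + d) ≡ k * A + (m + d)
  left = solve-∀
  right : ∀ k q m B → m + k * q + k * B ≡ m + k * (q + B)
  right = solve-∀
  multiple : κ * A + d ≡ κ * (q + B)
  multiple = +-cancelˡ-≡ m _ _ (trans (left κ A m d) (trans eq (right κ q m B)))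
... | q , inj₂ refl = ∣m+n∣m⇒∣n (subst (κ ∣_) (sym multiple) (m∣m*n B)) (m∣m*n (A + q))
  where
  left : ∀ k A q y d → y + (k * (A + q) + d) ≡ k * A + (y + k * q + d)
  left = solve-∀
  multiple : κ * (A + q) + d ≡ κ * B
  multiple = +-cancelˡ-≡ y _ _ (trans (left κ A q y d) eq)

-- The residues are taken from 1 to κ. Two different ones differ by less than κ, but by congruence
-- their difference is a positive multiple of κ.
residue-unique : ∀ {b b′ κ} L → 1 ≤ b → b ≤ κ → 1 ≤ b′ → b′ ≤ κ → b ≡ κ * L + b′ modulo κ → b ≡ b′
residue-unique {b} {b′} {κ} L 1≤b b≤κ 1≤b′ b′≤κ b≡ with <-cmp b b′
... | tri≈ _ b≡b′ _ = b≡b′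
... | tri< b<b′ _ _ = contradiction b′≤κ (<⇒≱ (≤-trans (s≤s κ≤d) (≤-trans (+-monoˡ-≤ d 1≤b) (≤-reflexive (m+[n∸m]≡n (<⇒≤ b<b′))))))
  where
  d = b′ ∸ b
  κ≤d : κ ≤ d
  κ≤d = ∣⇒≤ ⦃ >-nonZero (m<n⇒0<n∸m b<b′) ⦄ (modulo⇒∣ b≡ L 0 d
    (trans (cong (κ * L +_) (m+[n∸m]≡n (<⇒≤ b<b′))) (sym (trans (cong (κ * L + b′ +_) (*-zeroʳ κ)) (+-identityʳ _)))))
... | tri> _ _ b′<b = contradiction b≤κ (<⇒≱ (≤-trans (s≤s κ≤d) (≤-trans (+-monoˡ-≤ d 1≤b′) (≤-reflexive (m+[n∸m]≡n (<⇒≤ b′<b))))))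
  where
  d = b ∸ b′
  regroup : ∀ k L b′ d → k * 0 + (k * L + b′ + d) ≡ (b′ + d) + k * L
  regroup = solve-∀
  κ≤d : κ ≤ d
  κ≤d = ∣⇒≤ ⦃ >-nonZero (m<n⇒0<n∸m b′<b) ⦄ (modulo⇒∣ (subst (κ ∣_) (∣-∣-comm b _) b≡) 0 L d
    (trans (regroup κ L b′ d) (cong (_+ κ * L) (m+[n∸m]≡n (<⇒≤ b′<b)))))

2*nC2 : ∀ n → 2 * (n C 2) + n ≡ n * n
2*nC2 zero    = refl
2*nC2 (suc n) = begin
  2 * (suc n C 2) + suc n
    ≡⟨ cong (λ c → 2 * c + suc n) (trans (sym (nCk+nC[k+1]≡[n+1]C[k+1] n 1)) (cong (_+ n C 2) (nC1≡n n))) ⟩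
  2 * (n + n C 2) + suc n             ≡⟨ regroup n (n C 2) ⟩
  (2 * (n C 2) + n) + (2 * n + 1)     ≡⟨ cong (_+ (2 * n + 1)) (2*nC2 n) ⟩
  n * n + (2 * n + 1)                 ≡⟨ square n ⟩
  suc n * suc n                       ∎
  where
  open ≡-Reasoning
  regroup : ∀ n c → 2 * (n + c) + suc n ≡ (2 * c + n) + (2 * n + 1)
  regroup = solve-∀
  square : ∀ n → n * n + (2 * n + 1) ≡ suc n * suc n
  square = solve-∀

-- The four terms count the arcs at the first vertex, inside the `ℓ` blocks, between consecutive
-- blocks up to `K_a` with `a = κ`, and in the complete graph formed by the last two summands. The
-- proof eliminates the total distance from `pathComplete-size` and `2*endDistance`.
terminal-size : ∀ κ ℓ b → 1 ≤ κ → 1 ≤ ℓ →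
  2 * graphSize (pathComplete κ ℓ κ b) ≡ 2 * κ + κ * ℓ * (κ ∸ 1) + 2 * (κ * (κ * ℓ)) + (κ + b) * ((κ ∸ 1) + b)
terminal-size (suc k) ℓ b 1≤κ 1≤ℓ = +-cancelˡ-≡ (2 * κ * σ + (suc N + 2 * κ * κ)) _ _ (begin
  2 * κ * σ + (suc N + 2 * κ * κ) + z       ≡⟨ left (2 * κ * σ) z (suc N) (2 * κ * κ) ⟩
  2 * κ * σ + z + suc N + 2 * κ * κ         ≡⟨ pathComplete-size κ κ b 1≤ℓ N refl ⟩
  N * N + 4 * κ * N + 1 + 2 * κ             ≡⟨ right k ℓ b ⟩
  κ * (κ * (ℓ * suc ℓ) + 2 * (suc ℓ * κ + suc (suc ℓ) * b)) + (suc N + 2 * κ * κ) + goal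
    ≡⟨ cong (λ x → κ * x + (suc N + 2 * κ * κ) + goal) (2*endDistance κ ℓ κ b) ⟨
  κ * (2 * σ) + (suc N + 2 * κ * κ) + goal
    ≡⟨ cong (λ x → x + (suc N + 2 * κ * κ) + goal) (reorder κ σ) ⟩
  2 * κ * σ + (suc N + 2 * κ * κ) + goal    ∎)
  where
  open ≡-Reasoning
  κ = suc k
  N = κ * ℓ + (κ + b)
  σ = endDistance κ ℓ κ b
  z = 2 * graphSize (pathComplete κ ℓ κ b)
  goal = 2 * κ + κ * ℓ * k + 2 * (κ * (κ * ℓ)) + (κ + b) * (k + b)
  left : ∀ s z n c → s + (n + c) + z ≡ s + z + n + c
  left = solve-∀
  reorder : ∀ k s → k * (2 * s) ≡ 2 * k * s
  reorder = solve-∀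
  right : ∀ k ℓ b →
    (suc k * ℓ + (suc k + b)) * (suc k * ℓ + (suc k + b)) + 4 * suc k * (suc k * ℓ + (suc k + b)) + 1 + 2 * suc k
    ≡ suc k * (suc k * (ℓ * suc ℓ) + 2 * (suc ℓ * suc k + suc (suc ℓ) * b)) + (suc (suc k * ℓ + (suc k + b)) + 2 * suc k * suc k)
      + (2 * suc k + suc k * ℓ * k + 2 * (suc k * (suc k * ℓ)) + (suc k + b) * (k + b))
  right = solve-∀

-- For this order the threshold is exactly the size of the graph with `a = κ`; doubling clears the
-- factor one half.
threshold⇒terminal-size≤ : ∀ κ ℓ b {m} → 1 ≤ κ → 1 ≤ ℓ →
  sharpnessThreshold (suc (κ * ℓ + (κ + b))) κ b ℚ.≤ m ⁄ 1 → graphSize (pathComplete κ ℓ κ b) ≤ m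
threshold⇒terminal-size≤ (suc k) ℓ b {m} 1≤κ 1≤ℓ threshold≤ = *-cancelˡ-≤ 2
  (subst (_≤ 2 * m) (sym (terminal-size (suc k) ℓ b 1≤κ 1≤ℓ))
    (ℤ.drop‿+≤+ (subst (ℤ._≤ pos (2 * m)) value (½-≤ _ m threshold≤))))
  where
  open ≡-Reasoning
  κ = suc k
  identity : ∀ k ℓ b → let κ = 1ℤ ℤ.+ k in
    (1ℤ ℤ.+ (κ ℤ.* ℓ ℤ.+ (κ ℤ.+ b))) ℤ.* (pos 3 ℤ.* κ ℤ.- 1ℤ) ℤ.- pos 2 ℤ.* (κ ℤ.* κ) ℤ.- κ ℤ.+ 1ℤ ℤ.- b ℤ.* (κ ℤ.- b)
    ≡ pos 2 ℤ.* κ ℤ.+ κ ℤ.* ℓ ℤ.* k ℤ.+ pos 2 ℤ.* (κ ℤ.* (κ ℤ.* ℓ)) ℤ.+ (κ ℤ.+ b) ℤ.* (k ℤ.+ b)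
  identity = ℤ-Solver.solve-∀
  -- `pos` commutes with sums by computation but not with products, so the product of κ and `ℓ` is
  -- abstracted and replaced separately.
  lower upper : ℤ → ℤ
  lower κℓ =
    (1ℤ ℤ.+ (κℓ ℤ.+ (pos κ ℤ.+ pos b))) ℤ.* (pos 3 ℤ.* pos κ ℤ.- 1ℤ) ℤ.- pos 2 ℤ.* (pos κ ℤ.* pos κ) ℤ.- pos κ ℤ.+ 1ℤ ℤ.- pos b ℤ.* (pos κ ℤ.- pos b)
  upper κℓ =
    pos 2 ℤ.* pos κ ℤ.+ κℓ ℤ.* pos k ℤ.+ pos 2 ℤ.* (pos κ ℤ.* κℓ) ℤ.+ (pos κ ℤ.+ pos b) ℤ.* (pos k ℤ.+ pos b)
  cast : upper (pos (κ * ℓ)) ≡ pos (2 * κ + κ * ℓ * k + 2 * (κ * (κ * ℓ)) + (κ + b) * (k + b))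
  cast = cong₂ ℤ._+_ (cong₂ ℤ._+_ (cong₂ ℤ._+_ (sym (ℤ.pos-* 2 κ)) (sym (ℤ.pos-* (κ * ℓ) k)))
           (trans (cong (pos 2 ℤ.*_) (sym (ℤ.pos-* κ (κ * ℓ)))) (sym (ℤ.pos-* 2 (κ * (κ * ℓ))))))
           (sym (ℤ.pos-* (κ + b) (k + b)))
  value : lower (pos (κ * ℓ)) ≡ pos (2 * κ + κ * ℓ * k + 2 * (κ * (κ * ℓ)) + (κ + b) * (k + b))
  value = begin
    lower (pos (κ * ℓ))            ≡⟨ cong lower (ℤ.pos-* κ ℓ) ⟩
    lower (pos κ ℤ.* pos ℓ)        ≡⟨ identity (pos k) (pos ℓ) (pos b) ⟩
    upper (pos κ ℤ.* pos ℓ)        ≡⟨ cong upper (ℤ.pos-* κ ℓ) ⟨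
    upper (pos (κ * ℓ))            ≡⟨ cast ⟩
    pos (2 * κ + κ * ℓ * k + 2 * (κ * (κ * ℓ)) + (κ + b) * (k + b)) ∎

-- A predicate of `n` and the graph, so that the result for explicit parameters can be transported
-- along equations.
Conclusion : (κ n m₀ : ℕ) → Graph → Set
Conclusion κ n m₀ PK =
    (∀ D → Admissible n m₀ κ D → remoteness D ℚ.≤ remoteness (bidirected PK))
    × remoteness (bidirected PK) ≡ remotenessBound n (graphSize PK) κ
    × remoteness (bidirected PK) ℚ.≤ remotenessBound n m₀ κ
    × (∃[ D ] Admissible n m₀ κ D × remoteness D ≡ remoteness (bidirected PK))
    × (∀ b → 1 ≤ b → b ≤ κ → b ≡ n ∸ 1 modulo κ →
    m₀ ≡ (n ∸ 1) C 2 modulo κ →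
    sharpnessThreshold n κ b ℚ.≤ m₀ ⁄ 1 → m₀ ≤ (n ∸ 1) C 2 →
    remoteness (bidirected PK) ≡ remotenessBound n m₀ κ
    × (∃[ D ] Admissible n m₀ κ D × remoteness D ≡ remotenessBound n m₀ κ))

module Minimum {κ ℓ a b m₀ : ℕ} (1≤κ : 1 ≤ κ) (1≤ℓ : 1 ≤ ℓ) (κ≤a : κ ≤ a) (1≤b : 1 ≤ b) (N : ℕ) (N≡ : κ * ℓ + (a + b) ≡ N)
  (m₀≤size : m₀ ≤ graphSize (pathComplete κ ℓ a b))
  (minimum : ∀ ℓ′ a′ b′ → 1 ≤ ℓ′ → κ ≤ a′ → 1 ≤ b′ → κ * ℓ′ + (a′ + b′) ≡ N →
             m₀ ≤ graphSize (pathComplete κ ℓ′ a′ b′) →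
             graphSize (pathComplete κ ℓ a b) ≤ graphSize (pathComplete κ ℓ′ a′ b′)) where

  PK : Graph
  PK = pathComplete κ ℓ a b

  open PathCompleteDistances 1≤κ 1≤ℓ κ≤a b hiding (N; order≡) renaming (D to PK↔)

  σ : ℕ
  σ = endDistance κ ℓ a b

  σ-size : 2 * κ * σ + 2 * graphSize PK + suc N + 2 * κ * κ ≡ N * N + 4 * κ * N + 1 + 2 * κ
  σ-size = pathComplete-size κ a b 1≤ℓ N N≡

  κ≤N : κ ≤ N
  κ≤N = ≤-trans κ≤a (≤-trans (m≤m+n a b) (≤-trans (m≤n+m (a + b) (κ * ℓ)) (≤-reflexive N≡)))

  1≤N : 1 ≤ N
  1≤N = ≤-trans 1≤κ κ≤N

  order≡ : Digraph.order PK↔ ≡ suc N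
  order≡ = cong suc (trans (order-layersAfter1 κ ℓ a b) N≡)

  -- Both main estimates use this dichotomy: a successor turns out to have fewer than `m₀` edges,
  -- and a terminal graph is compared directly.
  data Position : Set where
    successor : ∀ ℓ′ a′ b′ → 1 ≤ ℓ′ → κ ≤ a′ → 1 ≤ b′ → κ * ℓ′ + (a′ + b′) ≡ N →
                endDistance κ ℓ′ a′ b′ ≡ suc σ → Position
    terminal  : a ≡ κ → b ≤ κ → Position

  position : Position
  position with a ≟ κ
  -- As `a > κ`, one vertex can move from `K_a` to `K_b`, one level up.
  ... | no a≢κ = go a κ≤a a≢κ N≡ refl
    where
    shift : ∀ k ℓ c b → k * (ℓ * suc ℓ) + 2 * (suc ℓ * c + suc (suc ℓ) * suc b)
      ≡ k * (ℓ * suc ℓ) + 2 * (suc ℓ * suc c + suc (suc ℓ) * b) + 2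
    shift = solve-∀
    go : ∀ c → κ ≤ c → c ≢ κ → κ * ℓ + (c + b) ≡ N → endDistance κ ℓ c b ≡ σ → Position
    go zero    κ≤0 _   _  _  = contradiction (≤-trans 1≤κ κ≤0) λ ()
    go (suc c) κ≤c c≢κ eq σ≡ = successor ℓ c (suc b) 1≤ℓ (s≤s⁻¹ (≤∧≢⇒< κ≤c (≢-sym c≢κ))) (s≤s z≤n)
      (trans (cong (κ * ℓ +_) (+-suc c b)) eq)
      (*-cancelˡ-≡ _ _ 2 (begin
        2 * endDistance κ ℓ c (suc b)
          ≡⟨ 2*endDistance κ ℓ c (suc b) ⟩
        κ * (ℓ * suc ℓ) + 2 * (suc ℓ * c + suc (suc ℓ) * suc b)                   ≡⟨ shift κ ℓ c b ⟩
        κ * (ℓ * suc ℓ) + 2 * (suc ℓ * suc c + suc (suc ℓ) * b) + 2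
          ≡⟨ cong (_+ 2) (2*endDistance κ ℓ (suc c) b) ⟨
        2 * endDistance κ ℓ (suc c) b + 2
          ≡⟨ cong (λ s → 2 * s + 2) σ≡ ⟩
        2 * σ + 2
          ≡⟨ trans (+-comm (2 * σ) 2) (sym (*-suc 2 σ)) ⟩
        2 * suc σ                                                                 ∎))
      where open ≡-Reasoning
  ... | yes a≡κ with b ≤? κ
  ...   | yes b≤κ = terminal a≡κ b≤κ
  -- Here `K_a` becomes one more block `K_κ`, and one vertex of `K_b` moves up to a new last level;
  -- the remaining `b - 1 ≥ κ` vertices form the new `K_a`.
  ...   | no  b≰κ = go b (≰⇒> b≰κ) (trans (cong (λ a → κ * ℓ + (a + b)) (sym a≡κ)) N≡) (cong (λ a → endDistance κ ℓ a b) (sym a≡κ))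
    where
    shift : ∀ k ℓ c → k * (suc ℓ * suc (suc ℓ)) + 2 * (suc (suc ℓ) * c + suc (suc (suc ℓ)) * 1)
      ≡ k * (ℓ * suc ℓ) + 2 * (suc ℓ * k + suc (suc ℓ) * suc c) + 2
    shift = solve-∀
    order-shift : ∀ k ℓ c → k * suc ℓ + (c + 1) ≡ k * ℓ + (k + suc c)
    order-shift = solve-∀
    go : ∀ c → κ < c → κ * ℓ + (κ + c) ≡ N → endDistance κ ℓ κ c ≡ σ → Position
    go (suc c) (s≤s κ≤c) eq σ≡ = successor (suc ℓ) c 1 (s≤s z≤n) κ≤c ≤-refl
      (trans (order-shift κ ℓ c) eq)
      (*-cancelˡ-≡ _ _ 2 (begin
        2 * endDistance κ (suc ℓ) c 1
          ≡⟨ 2*endDistance κ (suc ℓ) c 1 ⟩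
        κ * (suc ℓ * suc (suc ℓ)) + 2 * (suc (suc ℓ) * c + suc (suc (suc ℓ)) * 1)
          ≡⟨ shift κ ℓ c ⟩
        κ * (ℓ * suc ℓ) + 2 * (suc ℓ * κ + suc (suc ℓ) * suc c) + 2
          ≡⟨ cong (_+ 2) (2*endDistance κ ℓ κ (suc c)) ⟨
        2 * endDistance κ ℓ κ (suc c) + 2
          ≡⟨ cong (λ s → 2 * s + 2) σ≡ ⟩
        2 * σ + 2
          ≡⟨ trans (+-comm (2 * σ) 2) (sym (*-suc 2 σ)) ⟩
        2 * suc σ                                                                             ∎))
      where open ≡-Reasoning

  -- For fixed order, `pathComplete-size` keeps κ times the total distance plus the size constant.
  successor-size : ∀ {ℓ′ a′ b′} → 1 ≤ ℓ′ → κ * ℓ′ + (a′ + b′) ≡ N → endDistance κ ℓ′ a′ b′ ≡ suc σ →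
                   graphSize (pathComplete κ ℓ′ a′ b′) + κ ≡ graphSize PK
  successor-size {ℓ′} {a′} {b′} 1≤ℓ′ N≡′ σ≡ = *-cancelˡ-≡ _ _ 2 (+-cancelˡ-≡ (2 * κ * σ + (suc N + 2 * κ * κ)) _ _ (begin
    2 * κ * σ + (suc N + 2 * κ * κ) + 2 * (z + κ)         ≡⟨ left κ σ N z ⟩
    2 * κ * suc σ + 2 * z + suc N + 2 * κ * κ
      ≡⟨ cong (λ s → 2 * κ * s + 2 * z + suc N + 2 * κ * κ) σ≡ ⟨
    2 * κ * endDistance κ ℓ′ a′ b′ + 2 * z + suc N + 2 * κ * κ ≡⟨ pathComplete-size κ a′ b′ 1≤ℓ′ N N≡′ ⟩
    N * N + 4 * κ * N + 1 + 2 * κ                         ≡⟨ σ-size ⟨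
    2 * κ * σ + 2 * graphSize PK + suc N + 2 * κ * κ
      ≡⟨ right (2 * κ * σ) (2 * graphSize PK) (suc N) (2 * κ * κ) ⟩
    2 * κ * σ + (suc N + 2 * κ * κ) + 2 * graphSize PK    ∎))
    where
    open ≡-Reasoning
    z = graphSize (pathComplete κ ℓ′ a′ b′)
    left : ∀ k s N z → 2 * k * s + (suc N + 2 * k * k) + 2 * (z + k)
      ≡ 2 * k * suc s + 2 * z + suc N + 2 * k * k
    left = solve-∀
    right : ∀ s z n c → s + z + n + c ≡ s + (n + c) + z
    right = solve-∀

  -- With at least `m₀` edges, the successor would contradict the minimality of `PK`, having κ fewer
  -- edges.
  size<m₀ : ∀ {ℓ′ a′ b′} → 1 ≤ ℓ′ → κ ≤ a′ → 1 ≤ b′ → κ * ℓ′ + (a′ + b′) ≡ N → endDistance κ ℓ′ a′ b′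
    ≡ suc σ →
              graphSize (pathComplete κ ℓ′ a′ b′) < m₀
  size<m₀ {ℓ′} {a′} {b′} 1≤ℓ′ κ≤a′ 1≤b′ N≡′ σ≡ = ≰⇒> λ m₀≤z →
    <-irrefl refl (begin-strict
      z               <⟨ m<m+n z 1≤κ ⟩
      z + κ           ≡⟨ successor-size 1≤ℓ′ N≡′ σ≡ ⟩
      graphSize PK    ≤⟨ minimum ℓ′ a′ b′ 1≤ℓ′ κ≤a′ 1≤b′ N≡′ m₀≤z ⟩
      z               ∎)
    where
    open ≤-Reasoning
    z = graphSize (pathComplete κ ℓ′ a′ b′)

  totalDistance-bound : ∀ D → Admissible (suc N) m₀ κ D → ∀ v → totalDistance D v ≤ σ
  totalDistance-bound D adm v = ≮⇒≥ (impossible position)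
    where
    open Admissible adm renaming (connected to conn; eulerian to euler; order≡n to orderD≡)
    open Bounds 1≤κ D conn euler v
    impossible : Position → ¬ σ < totalDistance D v
    -- The bound for `D`, with total distance at least `suc σ` and size at least `2 * m₀`, is
    -- compared with the equality for the successor; this would give the successor at least `m₀`
    -- edges.
    impossible (successor ℓ′ a′ b′ 1≤ℓ′ κ≤a′ 1≤b′ N≡′ σ≡) σ<total = <⇒≱ (size<m₀ 1≤ℓ′ κ≤a′ 1≤b′ N≡′ σ≡)
      (*-cancelˡ-≤ 2 (+-cancelˡ-≤ (2 * κ * suc σ) _ _ (+-cancelʳ-≤ (suc N) _ _ (+-cancelʳ-≤ (2 * κ * κ) _ _ (begin
        2 * κ * suc σ + 2 * m₀ + suc N + 2 * κ * κ
          ≤⟨ +-monoˡ-≤ (2 * κ * κ) (+-monoˡ-≤ (suc N) (+-mono-≤ (*-monoʳ-≤ (2 * κ) σ<total) 2m₀≤size)) ⟩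
        2 * κ * totalDistance D v + Digraph.size D + suc N + 2 * κ * κ
          ≤⟨ totalDistance-size orderD≡ κ≤N ⟩
        N * N + 4 * κ * N + 1 + 2 * κ
          ≡⟨ pathComplete-size κ a′ b′ 1≤ℓ′ N N≡′ ⟨
        2 * κ * endDistance κ ℓ′ a′ b′ + 2 * graphSize (pathComplete κ ℓ′ a′ b′) + suc N + 2 * κ * κ
          ≡⟨ cong (λ s → 2 * κ * s + 2 * graphSize (pathComplete κ ℓ′ a′ b′) + suc N + 2 * κ * κ) σ≡ ⟩
        2 * κ * suc σ + 2 * graphSize (pathComplete κ ℓ′ a′ b′) + suc N + 2 * κ * κ ∎)))))
      where open ≤-Reasoning
    impossible (terminal a≡κ b≤κ) σ<total = <⇒≱ σ<total (*-cancelˡ-≤ 2 (begin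
      2 * totalDistance D v
        -- Since `a = κ`, there are `suc ℓ` full levels of size κ between the root and the last
        -- level.
        ≤⟨ ∑-≤ (suc ℓ) b 1≤b b≤κ (trans orderD≡ (cong suc N≡L)) ⟩
      κ * (suc (suc ℓ) * suc ℓ) + 2 * (suc (suc ℓ) * b)                 ≡⟨ regroup κ ℓ b ⟩
      κ * (ℓ * suc ℓ) + 2 * (suc ℓ * κ + suc (suc ℓ) * b)
        ≡⟨ cong (λ a → κ * (ℓ * suc ℓ) + 2 * (suc ℓ * a + suc (suc ℓ) * b)) a≡κ ⟨
      κ * (ℓ * suc ℓ) + 2 * (suc ℓ * a + suc (suc ℓ) * b)               ≡⟨ 2*endDistance κ ℓ a b ⟨
      2 * σ                                                             ∎))
      where
      open ≤-Reasoning
      regroup : ∀ k ℓ b → k * (suc (suc ℓ) * suc ℓ) + 2 * (suc (suc ℓ) * b)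
        ≡ k * (ℓ * suc ℓ) + 2 * (suc ℓ * k + suc (suc ℓ) * b)
      regroup = solve-∀
      order-shift : ∀ k ℓ b → k * ℓ + (k + b) ≡ k * suc ℓ + b
      order-shift = solve-∀
      N≡L : N ≡ κ * suc ℓ + b
      N≡L = trans (sym N≡) (trans (cong (λ a → κ * ℓ + (a + b)) a≡κ) (order-shift κ ℓ b))

  size≡m₀ : ∀ {c} → 1 ≤ c → c ≤ κ → c ≡ N modulo κ → m₀ ≡ N C 2 modulo κ →
            sharpnessThreshold (suc N) κ c ℚ.≤ m₀ ⁄ 1 → graphSize PK ≡ m₀
  size≡m₀ {c} 1≤c c≤κ c≡N m₀≡ threshold≤ = ≤-antisym (≮⇒≥ (impossible position)) m₀≤size
    where
    d = graphSize PK ∸ m₀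
    -- Half of `σ-size`, with the square of `N` rewritten by `2*nC2`: the size of `PK` is congruent
    -- to `N C 2`, hence to `m₀`, modulo κ.
    congruence : κ * (σ + κ) + graphSize PK ≡ N C 2 + κ * (2 * N + 1)
    congruence = *-cancelˡ-≡ _ _ 2 (+-cancelʳ-≡ (suc N) _ _ (begin
      2 * (κ * (σ + κ) + graphSize PK) + suc N                  ≡⟨ left κ σ (graphSize PK) (suc N) ⟩
      2 * κ * σ + 2 * graphSize PK + suc N + 2 * κ * κ          ≡⟨ σ-size ⟩
      N * N + 4 * κ * N + 1 + 2 * κ
        ≡⟨ cong (λ s → s + 4 * κ * N + 1 + 2 * κ) (2*nC2 N) ⟨
      2 * (N C 2) + N + 4 * κ * N + 1 + 2 * κ                   ≡⟨ right κ (N C 2) N ⟩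
      2 * (N C 2 + κ * (2 * N + 1)) + suc N                     ∎))
      where
      open ≡-Reasoning
      left : ∀ k s z n → 2 * (k * (s + k) + z) + n ≡ 2 * k * s + 2 * z + n + 2 * k * k
      left = solve-∀
      right : ∀ k c N → 2 * c + N + 4 * k * N + 1 + 2 * k ≡ 2 * (c + k * (2 * N + 1)) + suc N
      right = solve-∀
    impossible : Position → ¬ m₀ < graphSize PK
    impossible (successor ℓ′ a′ b′ 1≤ℓ′ κ≤a′ 1≤b′ N≡′ σ≡) m₀<size = <⇒≱ (size<m₀ 1≤ℓ′ κ≤a′ 1≤b′ N≡′ σ≡)
      (+-cancelʳ-≤ κ _ _ (begin
        m₀ + κ                                       ≤⟨ +-monoʳ-≤ m₀ κ≤d ⟩
        m₀ + d                                       ≡⟨ m+[n∸m]≡n m₀≤size ⟩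
        graphSize PK                                 ≡⟨ successor-size 1≤ℓ′ N≡′ σ≡ ⟨
        graphSize (pathComplete κ ℓ′ a′ b′) + κ      ∎))
      where
      open ≤-Reasoning
      κ≤d : κ ≤ d
      -- The surplus `d` is a positive multiple of κ, so even the successor, with κ fewer edges,
      -- would keep at least `m₀`.
      κ≤d = ∣⇒≤ ⦃ >-nonZero (m<n⇒0<n∸m m₀<size) ⦄ (modulo⇒∣ m₀≡ (σ + κ) (2 * N + 1) d
        (trans (cong (κ * (σ + κ) +_) (m+[n∸m]≡n m₀≤size)) congruence))
    impossible (terminal a≡κ b≤κ) m₀<size = <⇒≱ m₀<size
      (subst (λ a → graphSize (pathComplete κ ℓ a b) ≤ m₀) (sym a≡κ)
        (threshold⇒terminal-size≤ κ ℓ b 1≤κ 1≤ℓ (subst₂ (λ n c → sharpnessThreshold (suc n) κ c ℚ.≤ m₀ ⁄ 1) N≡κ c≡b threshold≤)))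
      where
      N≡κ : N ≡ κ * ℓ + (κ + b)
      N≡κ = trans (sym N≡) (cong (λ a → κ * ℓ + (a + b)) a≡κ)
      order-shift : ∀ k ℓ b → k * ℓ + (k + b) ≡ k * suc ℓ + b
      order-shift = solve-∀
      c≡b : c ≡ b
      -- The given residue is the parameter `b` of the terminal graph, so the threshold is the size
      -- of that graph.
      c≡b =
        residue-unique (suc ℓ) 1≤c c≤κ 1≤b b≤κ (subst (c ≡_modulo κ) (trans N≡κ (order-shift κ ℓ b)) c≡N)

  remoteness-PK : remoteness PK↔ ≡ σ ⁄ N
  remoteness-PK = ℚ.≤-antisym (remoteness-≤ PK↔ 1≤N order≡ totalDistance-≤)
    (ℚ.≤-trans (⁄N-mono-≤ PK↔ 1≤N order≡ endDistance-≤) (remoteness-≥ PK↔ 1≤N order≡ zero))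

  -- The bidirected graph is itself the extremal digraph in both existence claims.
  admissible : Admissible (suc N) m₀ κ PK↔
  admissible = record
    { connected = connected
    ; eulerian  = eulerian zero
    ; order≡n   = order≡
    ; 2m₀≤size  = ≤-trans (*-monoʳ-≤ 2 m₀≤size) (≤-reflexive (2*graphSize PK))
    }

  remoteness-bound : remoteness PK↔ ≡ remotenessBound (suc N) (graphSize PK) κ
  remoteness-bound = trans remoteness-PK (remotenessBound-⁄ 1≤κ 1≤N σ-size)

  conclusion : Conclusion κ (suc N) m₀ PK
  conclusion =
      (λ D adm → subst (remoteness D ℚ.≤_) (sym remoteness-PK)
                   (remoteness-≤ D 1≤N (Admissible.order≡n adm) (totalDistance-bound D adm)))
    , remoteness-bound
    , subst (ℚ._≤ remotenessBound (suc N) m₀ κ) (sym remoteness-bound) (remotenessBound-antimono 1≤κ 1≤N m₀≤size)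
    , (PK↔ , admissible , refl)
    , λ c 1≤c c≤κ c≡ m₀≡ threshold≤ _ →
        let sharp = trans remoteness-bound (cong (λ m → remotenessBound (suc N) m κ) (size≡m₀ 1≤c c≤κ c≡ m₀≡ threshold≤))
        in sharp , PK↔ , admissible , sharp

theorem4p3 : (κ n m₀ : ℕ) → 1 ≤ κ → 1 ≤ n → 1 ≤ m₀ →
    (PK : Graph) → IsMinimumPathComplete n m₀ κ PK →
    (∀ D → Admissible n m₀ κ D → remoteness D ℚ.≤ remoteness (bidirected PK))
    × remoteness (bidirected PK) ≡ remotenessBound n (graphSize PK) κ
    × remoteness (bidirected PK) ℚ.≤ remotenessBound n m₀ κ
    × (∃[ D ] Admissible n m₀ κ D × remoteness D ≡ remoteness (bidirected PK))
    × (∀ b → 1 ≤ b → b ≤ κ → b ≡ n ∸ 1 modulo κ →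
    m₀ ≡ (n ∸ 1) C 2 modulo κ →
    sharpnessThreshold n κ b ℚ.≤ m₀ ⁄ 1 → m₀ ≤ (n ∸ 1) C 2 →
    remoteness (bidirected PK) ≡ remotenessBound n m₀ κ
    × (∃[ D ] Admissible n m₀ κ D × remoteness D ≡ remotenessBound n m₀ κ))
theorem4p3 κ n m₀ 1≤κ _ _ PK
  record { pathComplete = ℓ , a , b , 1≤ℓ , _ , 1≤b , κ≤a , PK≡ ; order≡n = order≡n ; m₀≤size = m₀≤size ; minimum = minimum } =
  -- The parameters of `PK` determine both the graph and its order, so the claim is transported from
  -- `pathComplete κ ℓ a b` of order `suc N`.
  subst₂ (λ n G → Conclusion κ n m₀ G) (sym n≡) (sym PK≡layers)
    (Minimum.conclusion 1≤κ 1≤ℓ κ≤a 1≤b N refl (subst (λ G → m₀ ≤ graphSize G) PK≡layers m₀≤size) minimum′)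
  where
  N : ℕ
  N = κ * ℓ + (a + b)
  PK≡layers : PK ≡ pathComplete κ ℓ a b
  PK≡layers = trans PK≡ (pathComplete-def κ ℓ a b)
  n≡ : n ≡ suc N
  n≡ = trans (sym order≡n) (trans (cong order PK≡layers) (cong suc (order-layersAfter1 κ ℓ a b)))
  minimum′ : ∀ ℓ′ a′ b′ → 1 ≤ ℓ′ → κ ≤ a′ → 1 ≤ b′ → κ * ℓ′ + (a′ + b′) ≡ N →
             m₀ ≤ graphSize (pathComplete κ ℓ′ a′ b′) → graphSize (pathComplete κ ℓ a b) ≤ graphSize (pathComplete κ ℓ′ a′ b′)
  minimum′ ℓ′ a′ b′ 1≤ℓ′ κ≤a′ 1≤b′ N≡′ m₀≤ = subst (λ G → graphSize G ≤ graphSize (pathComplete κ ℓ′ a′ b′)) PK≡layers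
    (minimum (pathComplete κ ℓ′ a′ b′)
      (ℓ′ , a′ , b′ , 1≤ℓ′ , ≤-trans 1≤κ κ≤a′ , 1≤b′ , κ≤a′ , sym (pathComplete-def κ ℓ′ a′ b′))
      (trans (cong suc (trans (order-layersAfter1 κ ℓ′ a′ b′) N≡′)) (sym n≡)) m₀≤)
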